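{- Let $q'$ be a prime power with $q=(q')^{3}\geq 64$. Then for every codimension $r=3t+1\geq 7$ there exists a linear $[n_r,n_r-r]_q$ code $\mathcal{C}_r$ with covering radius $3$ and length $$n_r=\left(4+\frac{4}{\sqrt[3]{q}}\right)q^{\frac{r-3}{3}},$$ and the family satisfies $$\liminf_{r\to\infty}\frac{V_q(n_r,3)}{q^{r}}<\frac{32}{3}+\frac{32}{\sqrt[3]{q}}+\frac{32}{\sqrt[3]{q^{2}}}-\frac{64}{3q}.$$
   Context: For a prime power $q$, an $[n,n-r]_q$ code is a linear subspace of $F_q^n$ of dimension $n-r$; it has covering radius $R$ if every column of $F_q^{r}$ is a linear combination of at most $R$ columns of a parity-check matrix, and $R$ is the smallest such integer. $V_q(n,R)=\sum_{i=0}^{R}(q-1)^i\binom{n}{i}$ is the size of a Hamming sphere of radius $R$ in $F_q^n$; $V_q(n,R)/q^r$ is the covering density of an $[n,n-r]_qR$ code. -}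

module Defs where

open import Level using (Level)
open import Data.Nat as ℕ using (ℕ; zero; suc; _^_; _≤_; _∸_)
open import Data.Nat.Combinatorics using (_C_)
open import Data.Nat.Primality using (Prime)
open import Data.Fin using (Fin)
open import Data.Product using (Σ; ∃; _×_)
open import Data.Integer using (+_)
open import Data.Rational as ℚ using (ℚ; 0ℚ)
open import Algebra.Bundles using (CommutativeRing)
open import Relation.Nullary using (¬_)
open import Function.Definitions using (Injective; Surjective)
open import Relation.Binary.PropositionalEquality using (_≡_)
import Data.Fin as Fin

IsPrimePower : ℕ → Set
IsPrimePower q = Σ ℕ λ p → Σ ℕ λ k → Prime p × 1 ≤ k × q ≡ p ^ k

record FiniteField (c ℓ : Level) (q : ℕ) : Set (Level.suc (c Level.⊔ ℓ)) where
  field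
    commRing : CommutativeRing c ℓ
  open CommutativeRing commRing public
  field
    0≉1   : ¬ (0# ≈ 1#)
    inv   : ∀ x → ¬ (x ≈ 0#) → Σ Carrier λ y → x * y ≈ 1#
    enum  : Fin q → Carrier
    enum-injective  : Injective _≡_ _≈_ enum
    enum-surjective : Surjective _≡_ _≈_ enum

module _ {c ℓ : Level} {q : ℕ} (F : FiniteField c ℓ q) where
  open FiniteField F

  ∑ : ∀ {k} → (Fin k → Carrier) → Carrier
  ∑ {zero}  f = 0#
  ∑ {suc k} f = f Fin.zero + ∑ (λ j → f (Fin.suc j))

  CombOfAtMost : ∀ {r n} → (Fin r → Fin n → Carrier) → ℕ → (Fin r → Carrier) → Set (c Level.⊔ ℓ)
  CombOfAtMost {r} {n} H R v =
    Σ ℕ λ k → k ≤ R × Σ (Fin k → Fin n) λ idx → Σ (Fin k → Carrier) λ a →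
      ∀ (i : Fin r) → ∑ (λ j → a j * H i (idx j)) ≈ v i

  CoversWithin : ∀ {r n} → (Fin r → Fin n → Carrier) → ℕ → Set (c Level.⊔ ℓ)
  CoversWithin {r} H R = ∀ (v : Fin r → Carrier) → CombOfAtMost H R v

  -- the code with parity-check matrix H has covering radius exactly R
  -- (R works and R is the smallest such integer)
  HasCoveringRadius : ∀ {r n} → (Fin r → Fin n → Carrier) → ℕ → Set (c Level.⊔ ℓ)
  HasCoveringRadius H R = CoversWithin H R × (∀ R′ → R′ ℕ.< R → ¬ CoversWithin H R′)

V : ℕ → ℕ → ℕ → ℕ
V q n zero    = 1
V q n (suc R) = V q n R ℕ.+ (q ∸ 1) ^ suc R ℕ.* (n C suc R)

-- the rational a / b (with the convention a / 0 = 0; only used with b > 0)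
frac : ℕ → ℕ → ℚ
frac a zero    = 0ℚ
frac a (suc b) = (+ a) ℚ./ suc b

-- n_r = (4 + 4/q') q'^{r-3} = 4 q'^{r-3} + 4 q'^{r-4}   (where q = q'^3, r ≥ 7)
nLen : ℕ → ℕ → ℕ
nLen q′ r = 4 ℕ.* q′ ^ (r ∸ 3) ℕ.+ 4 ℕ.* q′ ^ (r ∸ 4)

LiminfLt : (ℕ → ℚ) → ℚ → Set
LiminfLt x c = Σ ℚ λ c′ → c′ ℚ.< c × (∀ N → Σ ℕ λ t → N ≤ t × x t ℚ.< c′)

{-# OPTIONS --safe #-}
module Submission where

-- Let Q = q′, q = Q³ and let K be the subfield {x : x^Q = x} of F, which has Q elements. Take four lines
-- of PG(3, Q) without a common transversal. The coordinates of any v in F⁴ satisfy a linear relation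
-- over K, so v lies in a plane defined over K; this plane meets the four lines in points that span it,
-- so v is an F-combination of three of the 4(Q + 1) points. Each line has enough points to make
-- the three points distinct and their coefficients nonzero. Hence the columns (h_j , ξ , β_j ξ , β_j² ξ)
-- with ξ ∈ F^m and distinct β_j ∈ F still have covering radius at most 3: given h_j₁, h_j₂, h_j₃, the
-- three vectors ξ solve a Vandermonde system. Two columns never suffice, since there are too few pairs.
-- The density tends to 32/3 (1 + 1/Q)³ (1 − 1/Q³)³ as m grows.

open import Defs
open import Level using (Level; _⊔_)
open import Data.Nat as ℕ using (ℕ; zero; suc; _≤_; _<_; _∸_; z≤n; s≤s; _!)
import Data.Nat.Properties as ℕ
open import Data.Nat.Combinatorics using (_C_; nCn≡1; nC1≡n; nCk+nC[k+1]≡[n+1]C[k+1]; k![n∸k]!∣n!)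
open import Data.Nat.Combinatorics.Specification using (nCk≡n!/k![n-k]!)
open import Data.Nat.Divisibility using (_∣_; divides; m∣m*n; ∣⇒≤; ∣1⇒≡1)
open import Data.Nat.DivMod using (m/n*n≡m)
open import Data.Nat.Primality using (Prime; euclidsLemma; prime⇒nonTrivial; prime⇒nonZero)
open import Data.Nat.Solver using (module +-*-Solver)
open +-*-Solver using () renaming (solve to ℕ-solve; con to ℕ-con; _:+_ to _⊕_; _:*_ to _⊗_; _:=_ to _⊜_)
import Data.Integer.Properties as ℤ
open import Data.Rational as ℚ using (toℚᵘ)
import Data.Rational.Properties as ℚ
open import Data.Rational.Unnormalised as ℚᵘ using (mkℚᵘ; *<*; *≡*)
import Data.Rational.Unnormalised.Properties as ℚᵘ
open import Data.Fin as Fin using (Fin; toℕ; fromℕ; inject₁; finToFun; funToFin)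
open import Data.Fin.Patterns using (0F; 1F; 2F; 3F)
import Data.Fin.Properties as Fin
open import Data.Fin.Permutation using (Permutation; permutation; _⟨$⟩ʳ_)
open import Data.List using (List; []; _∷_; length; _++_; replicate)
open import Data.List.Properties using (length-++; length-replicate)
open import Data.Maybe using (Maybe; just; nothing)
open import Data.Product using (Σ; ∃; ∃₂; _×_; _,_; proj₁; proj₂; uncurry)
open import Data.Sum using (_⊎_; inj₁; inj₂) renaming (map₂ to ⊎-map₂)
open import Data.Empty using (⊥-elim)
open import Function using (_∘_; case_of_)
open import Function.Definitions using (Injective)
open import Relation.Nullary using (¬_; Dec; yes; no; contradiction)
open import Relation.Nullary.Decidable using (map′; _×-dec_)
open import Relation.Unary using (Pred; Decidable)
open import Relation.Binary.PropositionalEquality as ≡ using (_≡_; _≢_)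
import Relation.Binary.Reasoning.Setoid as SetoidReasoning
open import Algebra.Bundles using (CommutativeRing; RawRing)
import Algebra.Properties.CommutativeMonoid.Sum as MonoidSum
import Algebra.Properties.CommutativeSemigroup as CommutativeSemigroupProps
import Algebra.Properties.CommutativeSemiring.Binomial as Binomial
import Algebra.Properties.CommutativeSemiring.Exp as Exp
import Algebra.Properties.Group as GroupProps
import Algebra.Properties.Ring as RingProps
import Algebra.Properties.Semiring.Mult as Mult
import Algebra.Properties.Semiring.Mult.TCOptimised as Mult′
import Algebra.Solver.Ring as Solver
open import Algebra.Solver.Ring.AlmostCommutativeRing

-- Solving equations in commutative rings

-- Three pairwise skew lines would not do: they have transversals, and a plane through a transversal
-- that contains none of the lines meets them in collinear points. In K² × K² the transversals of
-- the lines (x , 0), (0 , x), (x , x) are spanned by (x , 0) and (0 , x) for a fixed x, so the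
-- fourth line (x , A x) has to come from a matrix A without eigenvectors. The characteristic
-- polynomial t² - t - m of A is irreducible because m is not a value of t² - t on K; unlike
-- squaring, which is injective in characteristic 2, this map is never injective. The order of K
-- enters in both directions: at least Q elements force the K-linear relation between four
-- coordinates, and at most Q elements keep the number of points at 4 (Q + 1). Both bounds count
-- roots: K consists of roots of X^Q - X, its complement of roots of (X^(Q³ - 1) - 1) / (X^(Q - 1) -
-- 1), which has degree Q³ - Q.

normalise : ℕ × ℕ → ℕ × ℕ
normalise (suc a , suc b) = normalise (a , b)
normalise x               = x

-- A coefficient (a , b) stands for the integer a − b.
DifferenceRing : RawRing _ _
DifferenceRing = record
  { Carrier = ℕ × ℕ
  ; _≈_ = _≡_
  ; _+_ = λ (a , b) (c , d) → normalise (a ℕ.+ c , b ℕ.+ d)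
  ; _*_ = λ (a , b) (c , d) → normalise (a ℕ.* c ℕ.+ b ℕ.* d , a ℕ.* d ℕ.+ b ℕ.* c)
  ; -_ = λ (a , b) → b , a
  ; 0# = 0 , 0
  ; 1# = 1 , 0
  }

module RingSolver {c ℓ : Level} (R : CommutativeRing c ℓ) where
  open CommutativeRing R
  open RingProps ring
  open Mult semiring using (×-homo-+; ×-congˡ; ×1-homo-*) renaming (_×_ to _·_)
  open Mult′ semiring using (×ᵤ≈×) renaming (_×_ to _·′_)
  open CommutativeSemigroupProps +-commutativeSemigroup using (interchange)
  open SetoidReasoning setoid

  -- The second argument is split so that the constants 0 and 1 evaluate to 0# and 1# definitionally.
  eval : ℕ × ℕ → Carrier
  eval (a , zero)  = a ·′ 1#
  eval (a , suc b) = a ·′ 1# - suc b ·′ 1#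

  -- The uniform form of `eval`, for which the homomorphism laws hold without case distinctions.
  diff : ℕ × ℕ → Carrier
  diff (a , b) = a · 1# - b · 1#

  eval≈diff : ∀ x → eval x ≈ diff x
  eval≈diff (a , zero) = begin
    a ·′ 1#         ≈⟨ ×ᵤ≈× a 1# ⟨
    a · 1#          ≈⟨ +-identityʳ _ ⟨
    a · 1# + 0#     ≈⟨ +-congˡ -0#≈0# ⟨
    a · 1# - 0#     ∎
  eval≈diff (a , suc b) = +-cong (sym (×ᵤ≈× a 1#)) (-‿cong (sym (×ᵤ≈× (suc b) 1#)))

  sub-+ : ∀ x y z w → (x + z) - (y + w) ≈ (x - y) + (z - w)
  sub-+ x y z w = trans (+-congˡ (sym (-‿+-comm y w))) (interchange x z (- y) (- w))

  sub-cong : ∀ {x y z w} → x ≈ y → z ≈ w → x - z ≈ y - w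
  sub-cong p q = +-cong p (-‿cong q)

  diff-+ : ∀ a b c d → diff (a ℕ.+ c , b ℕ.+ d) ≈ diff (a , b) + diff (c , d)
  diff-+ a b c d = trans (sub-cong (×-homo-+ 1# a c) (×-homo-+ 1# b d)) (sub-+ _ _ _ _)

  sub-* : ∀ x y z w → (x * z + y * w) - (x * w + y * z) ≈ (x - y) * (z - w)
  sub-* x y z w = begin
    (x * z + y * w) - (x * w + y * z)       ≈⟨ +-congˡ (-‿cong (+-comm _ _)) ⟩
    (x * z + y * w) - (y * z + x * w)       ≈⟨ sub-+ _ _ _ _ ⟩
    (x * z - y * z) + (y * w - x * w)       ≈⟨ +-cong (sym (lem z x y)) (trans (+-comm _ _) (sym (lem′ x y w))) ⟩
    (x - y) * z + (x - y) * (- w)           ≈⟨ distribˡ _ _ _ ⟨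
    (x - y) * (z - w)                       ∎
    where
    lem : ∀ z x y → (x - y) * z ≈ x * z - y * z
    lem z x y = trans (distribʳ _ _ _) (+-congˡ (sym (-‿distribˡ-* y z)))
    lem′ : ∀ x y w → (x - y) * (- w) ≈ - (x * w) + y * w
    lem′ x y w = trans (distribʳ _ _ _) (+-cong (sym (-‿distribʳ-* x w))
      (trans (sym (-‿distribˡ-* y (- w))) (trans (-‿cong (sym (-‿distribʳ-* y w))) (-‿involutive _))))

  diff-* : ∀ a b c d → diff (a ℕ.* c ℕ.+ b ℕ.* d , a ℕ.* d ℕ.+ b ℕ.* c) ≈ diff (a , b) * diff (c , d)
  diff-* a b c d = trans (sub-cong (expand a c b d) (expand a d b c)) (sub-* _ _ _ _)
    where
    expand : ∀ m n m′ n′ → (m ℕ.* n ℕ.+ m′ ℕ.* n′) · 1# ≈ (m · 1#) * (n · 1#) + (m′ · 1#) * (n′ · 1#)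
    expand m n m′ n′ = trans (×-homo-+ 1# (m ℕ.* n) (m′ ℕ.* n′)) (+-cong (×1-homo-* m n) (×1-homo-* m′ n′))

  diff-neg : ∀ a b → diff (b , a) ≈ - diff (a , b)
  diff-neg a b = begin
    b · 1# - a · 1#         ≈⟨ +-comm _ _ ⟩
    - (a · 1#) + b · 1#     ≈⟨ +-congˡ (-‿involutive _) ⟨
    - (a · 1#) - - (b · 1#) ≈⟨ -‿+-comm _ _ ⟩
    - diff (a , b)          ∎

  diff-normalise : ∀ x → diff (normalise x) ≈ diff x
  diff-normalise (zero , b)      = refl
  diff-normalise (suc a , zero)  = refl
  diff-normalise (suc a , suc b) = begin
    diff (normalise (a , b))                ≈⟨ diff-normalise (a , b) ⟩
    a · 1# - b · 1#                         ≈⟨ +-identityˡ _ ⟨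
    0# + (a · 1# - b · 1#)                  ≈⟨ +-congʳ (-‿inverseʳ 1#) ⟨
    (1# - 1#) + (a · 1# - b · 1#)           ≈⟨ sub-+ _ _ _ _ ⟨
    diff (suc a , suc b)                    ∎

  almostCommutativeRing : AlmostCommutativeRing c ℓ
  almostCommutativeRing = fromCommutativeRing R

  morphism : DifferenceRing -Raw-AlmostCommutative⟶ almostCommutativeRing
  morphism = record
    { ⟦_⟧    = eval
    ; +-homo = λ x@(a , b) y@(c , d) →
        transfer (a ℕ.+ c , b ℕ.+ d) (diff-+ a b c d) (+-cong (eval≈diff x) (eval≈diff y))
    ; *-homo = λ x@(a , b) y@(c , d) →
        transfer (a ℕ.* c ℕ.+ b ℕ.* d , a ℕ.* d ℕ.+ b ℕ.* c) (diff-* a b c d) (*-cong (eval≈diff x) (eval≈diff y))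
    ; -‿homo = λ x@(a , b) → trans (eval≈diff (b , a)) (trans (diff-neg a b) (-‿cong (sym (eval≈diff x))))
    ; 0-homo = refl
    ; 1-homo = refl
    }
    where
    transfer : ∀ x {y z} → diff x ≈ y → z ≈ y → eval (normalise x) ≈ z
    transfer x p q = trans (eval≈diff (normalise x)) (trans (diff-normalise x) (trans p (sym q)))

  eval-cong : ∀ x y → Maybe (eval x ≈ eval y)
  eval-cong x@(a , b) y@(c , d) with a ℕ.+ d ℕ.≟ b ℕ.+ c
  ... | no _  = nothing
  ... | yes e = just (trans (eval≈diff x) (trans (+-cancelʳ (d · 1# - c · 1#) _ _ (begin
    diff (a , b) + diff (d , c) ≈⟨ diff-+ a b d c ⟨
    diff (a ℕ.+ d , b ℕ.+ c)    ≈⟨ sub-cong (×-congˡ e) refl ⟩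
    diff (b ℕ.+ c , b ℕ.+ c)    ≈⟨ -‿inverseʳ _ ⟩
    0#                          ≈⟨ -‿inverseʳ ((c ℕ.+ d) · 1#) ⟨
    diff (c ℕ.+ d , c ℕ.+ d)    ≈⟨ sub-cong refl (×-congˡ (ℕ.+-comm c d)) ⟩
    diff (c ℕ.+ d , d ℕ.+ c)    ≈⟨ diff-+ c d d c ⟩
    diff (c , d) + diff (d , c) ∎)) (sym (eval≈diff y))))

  open Solver DifferenceRing almostCommutativeRing morphism eval-cong public
    using (solve; con; _:+_; _:*_; _:-_; :-_; _:=_; Polynomial)

  :0 :1 : ∀ {n} → Polynomial n
  :0 = con (0 , 0)
  :1 = con (1 , 0)

-- Finite fields

prime∤! : ∀ {p} → Prime p → ∀ n → n < p → ¬ p ∣ n !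
prime∤! {p} pr zero n<p p∣1 = contradiction (∣1⇒≡1 p∣1) (ℕ.nonTrivial⇒≢1 {{prime⇒nonTrivial pr}})
prime∤! pr (suc n) n<p d with euclidsLemma (suc n) (n !) pr d
... | inj₁ d′ = ℕ.<⇒≱ n<p (∣⇒≤ d′)
... | inj₂ d′ = prime∤! pr n (ℕ.<-trans (ℕ.n<1+n n) n<p) d′

-- The prime p divides p! = (p C k) · k! · (p - k)!, but neither factorial, as both belong to
-- numbers below p.
prime∣C : ∀ {p} → Prime p → ∀ {k} → 0 < k → k < p → p ∣ p C k
prime∣C {p} pr {k} 0<k k<p with euclidsLemma (p C k) (k ! ℕ.* (p ∸ k) !) pr p∣prod
  where
  instance _ = k ℕ.!* (p ∸ k) !≢0
  p! : (p C k) ℕ.* (k ! ℕ.* (p ∸ k) !) ≡ p !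
  p! = ≡.trans (≡.cong (ℕ._* (k ! ℕ.* (p ∸ k) !)) (nCk≡n!/k![n-k]! (ℕ.<⇒≤ k<p)))
               (m/n*n≡m (k![n∸k]!∣n! (ℕ.<⇒≤ k<p)))
  p∣p! : ∀ {n} → 0 < n → n ∣ n !
  p∣p! {suc n} _ = m∣m*n (n !)
  p∣prod : p ∣ (p C k) ℕ.* (k ! ℕ.* (p ∸ k) !)
  p∣prod = ≡.subst (p ∣_) (≡.sym p!) (p∣p! (ℕ.<-trans 0<k k<p))
... | inj₁ d = d
... | inj₂ d with euclidsLemma (k !) ((p ∸ k) !) pr d
...   | inj₁ d′ = contradiction d′ (prime∤! pr k k<p)
...   | inj₂ d′ = contradiction d′ (prime∤! pr (p ∸ k) (ℕ.∸-monoʳ-< 0<k (ℕ.<⇒≤ k<p)))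

-- Both parts are enumerated without repetition and `total` ties their sizes together, so that an
-- upper bound for the complement becomes a lower bound for the subset.
record Split {ℓ n} (P : Pred (Fin n) ℓ) : Set ℓ where
  field
    #in #out      : ℕ
    total         : #in ℕ.+ #out ≡ n
    inside        : Fin #in → Fin n
    outside       : Fin #out → Fin n
    inside-inj    : Injective _≡_ _≡_ inside
    outside-inj   : Injective _≡_ _≡_ outside
    inside-∈      : ∀ i → P (inside i)
    outside-∉     : ∀ i → ¬ P (outside i)
    inside-onto   : ∀ j → P j → ∃ λ i → inside i ≡ j

split : ∀ {ℓ n} {P : Pred (Fin n) ℓ} → Decidable P → Split P
split {n = zero}  P? = record
  { #in = 0 ; #out = 0 ; total = ≡.refl ; inside = λ () ; outside = λ ()
  ; inside-inj = λ {} ; outside-inj = λ {} ; inside-∈ = λ () ; outside-∉ = λ () ; inside-onto = λ () }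
split {n = suc n} {P = P} P? with split (P? ∘ Fin.suc) | P? Fin.zero
... | S | yes p = record
  { #in = suc #in ; #out = #out ; total = ≡.cong suc total
  ; inside = Fin.lift 1 inside ; outside = Fin.suc ∘ outside
  ; inside-inj = Fin.lift-injective inside inside-inj 1
  ; outside-inj = outside-inj ∘ Fin.suc-injective
  ; inside-∈ = λ { Fin.zero → p ; (Fin.suc i) → inside-∈ i }
  ; outside-∉ = outside-∉
  ; inside-onto = λ { Fin.zero _ → Fin.zero , ≡.refl
                    ; (Fin.suc j) pj → let i , e = inside-onto j pj in Fin.suc i , ≡.cong Fin.suc e } }
  where open Split S
... | S | no ¬p = record
  { #in = #in ; #out = suc #out ; total = ≡.trans (ℕ.+-suc #in #out) (≡.cong suc total)
  ; inside = Fin.suc ∘ inside ; outside = Fin.lift 1 outside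
  ; inside-inj = inside-inj ∘ Fin.suc-injective
  ; outside-inj = Fin.lift-injective outside outside-inj 1
  ; inside-∈ = inside-∈
  ; outside-∉ = λ { Fin.zero → ¬p ; (Fin.suc i) → outside-∉ i }
  ; inside-onto = λ { Fin.zero p → contradiction p ¬p
                    ; (Fin.suc j) pj → let i , e = inside-onto j pj in i , ≡.cong Fin.suc e } }
  where open Split S

module FieldTheory {c ℓ : Level} {q : ℕ} (F : FiniteField c ℓ q) where
  open FiniteField F public
  open RingProps ring public using (-0#≈0#; x[y-z]≈xy-xz)
  open GroupProps +-group public using () renaming (x∙y⁻¹≈ε⇒x≈y to x-y≈0⇒x≈y; x≈y⇒x∙y⁻¹≈ε to x≈y⇒x-y≈0)
  open Exp commutativeSemiring public using (_^_; ^-congˡ; ^-congʳ; ^-assocʳ; ^-distrib-*)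
  open Mult semiring public using (×-congʳ; ×1-homo-*; ×-assoc-*) renaming (_×_ to _·_)
  open RingSolver commRing public
  open SetoidReasoning setoid
  private
    module Sum = MonoidSum +-commutativeMonoid
    module Prod = MonoidSum *-commutativeMonoid

  index : Carrier → Fin q
  index y = proj₁ (enum-surjective y)

  enum-index : ∀ y → enum (index y) ≈ y
  enum-index y = proj₂ (enum-surjective y) ≡.refl

  index-injective : ∀ {x y} → index x ≡ index y → x ≈ y
  index-injective {x} {y} e = trans (sym (enum-index x)) (trans (reflexive (≡.cong enum e)) (enum-index y))

  index-cong : ∀ {x y} → x ≈ y → index x ≡ index y
  index-cong e = enum-injective (trans (enum-index _) (trans e (sym (enum-index _))))

  index-enum : ∀ i → index (enum i) ≡ i
  index-enum i = enum-injective (enum-index (enum i))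

  infix 4 _≟_
  _≟_ : ∀ x y → Dec (x ≈ y)
  x ≟ y = map′ index-injective index-cong (index x Fin.≟ index y)

  *-cancel-≉0 : ∀ {x y} → ¬ x ≈ 0# → x * y ≈ 0# → y ≈ 0#
  *-cancel-≉0 {x} {y} x≉0 xy≈0 = let z , xz≈1 = inv x x≉0 in begin
    y             ≈⟨ *-identityˡ y ⟨
    1# * y        ≈⟨ *-congʳ (trans (*-comm z x) xz≈1) ⟨
    z * x * y     ≈⟨ *-assoc z x y ⟩
    z * (x * y)   ≈⟨ *-congˡ xy≈0 ⟩
    z * 0#        ≈⟨ zeroʳ z ⟩
    0#            ∎

  *-cancelˡ-≉0 : ∀ {x y z} → ¬ x ≈ 0# → x * y ≈ x * z → y ≈ z
  *-cancelˡ-≉0 x≉0 e = x-y≈0⇒x≈y _ _ (*-cancel-≉0 x≉0 (trans (x[y-z]≈xy-xz _ _ _) (x≈y⇒x-y≈0 e)))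

  *-≉0 : ∀ {x y} → ¬ x ≈ 0# → ¬ y ≈ 0# → ¬ x * y ≈ 0#
  *-≉0 x≉0 y≉0 e = y≉0 (*-cancel-≉0 x≉0 e)

  ^-≈0 : ∀ x n → x ^ n ≈ 0# → x ≈ 0#
  ^-≈0 x zero    e = contradiction (sym e) 0≉1
  ^-≈0 x (suc n) e with x ≟ 0#
  ... | yes x≈0 = x≈0
  ... | no x≉0  = ^-≈0 x n (*-cancel-≉0 x≉0 e)

  1^ : ∀ n → 1# ^ n ≈ 1#
  1^ zero    = refl
  1^ (suc n) = trans (*-identityˡ _) (1^ n)

  0^ : ∀ {n} → 0 < n → 0# ^ n ≈ 0#
  0^ {suc n} _ = zeroˡ _

  -- Sums and products over the field are indexed by `Fin q`; a bijection of the carrier up to `_≈_`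
  -- is therefore carried over to the indices.
  permute : (f g : Carrier → Carrier) → (∀ {x y} → x ≈ y → f x ≈ f y) → (∀ {x y} → x ≈ y → g x ≈ g y) →
            (∀ y → f (g y) ≈ y) → (∀ x → g (f x) ≈ x) → Permutation q q
  permute f g f-cong g-cong fg gf = permutation (index ∘ f ∘ enum) (index ∘ g ∘ enum)
    (λ i → ≡.trans (index-cong (trans (f-cong (enum-index _)) (fg _))) (index-enum i))
    (λ i → ≡.trans (index-cong (trans (g-cong (enum-index _)) (gf _))) (index-enum i))

  -- Translating all elements by x permutes them, so it does not change their sum.
  q·x≈0 : ∀ x → q · x ≈ 0#
  q·x≈0 x = begin
    q · x                        ≈⟨ solve 2 (λ a b → a := (a :+ b) :- b) refl (q · x) s ⟩
    (q · x + s) - s              ≈⟨ +-congʳ shifted ⟩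
    s - s                        ≈⟨ -‿inverseʳ s ⟩
    0#                           ∎
    where
    s = Sum.sum enum
    π = permute (x +_) (- x +_) +-congˡ +-congˡ
          (λ y → solve 2 (λ x y → x :+ (:- x :+ y) := y) refl x y)
          (λ y → solve 2 (λ x y → :- x :+ (x :+ y) := y) refl x y)
    shifted : q · x + s ≈ s
    shifted = begin
      q · x + s                           ≈⟨ +-congʳ (Sum.sum-replicate q) ⟨
      Sum.sum {q} (λ _ → x) + s           ≈⟨ Sum.∑-distrib-+ (λ _ → x) enum ⟨
      Sum.sum (λ i → x + enum i)          ≈⟨ Sum.sum-cong-≋ (λ i → enum-index (x + enum i)) ⟨
      Sum.sum (λ i → enum (π ⟨$⟩ʳ i))     ≈⟨ Sum.sum-permute enum π ⟨
      s                                   ∎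

  product-≉0 : ∀ {n} (f : Fin n → Carrier) → (∀ i → ¬ f i ≈ 0#) → ¬ Prod.sum f ≈ 0#
  product-≉0 {zero}  f f≉0 e = 0≉1 (sym e)
  product-≉0 {suc n} f f≉0 = *-≉0 (f≉0 Fin.zero) (product-≉0 (f ∘ Fin.suc) (f≉0 ∘ Fin.suc))

  -- The extra x makes up for the single factor 1, which will stand at the index of zero. In this
  -- way `x ^ q` appears without the exponent q - 1.
  product-except : ∀ {n x} (i : Fin n) (w : Fin n → Carrier) → w i ≈ 1# → (∀ j → j ≢ i → w j ≈ x) →
                   x * Prod.sum w ≈ x ^ n
  product-except {suc n} {x} i w wi≈1 wj≈x = *-congˡ (begin
    Prod.sum w                                    ≈⟨ Prod.sum-remove {i = i} w ⟩
    w i * Prod.sum (λ j → w (Fin.punchIn i j))    ≈⟨ *-cong wi≈1 (Prod.sum-cong-≋ (λ j → wj≈x _ (Fin.punchInᵢ≢i i j))) ⟩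
    1# * Prod.sum {n} (λ _ → x)                   ≈⟨ *-identityˡ _ ⟩
    Prod.sum {n} (λ _ → x)                        ≈⟨ Prod.sum-replicate n ⟩
    x ^ n                                         ∎)

  0<q : 0 < q
  0<q = ℕ.≤-<-trans z≤n (Fin.toℕ<n (index 0#))

  -- Multiplication by x ≠ 0 permutes the nonzero elements, so it does not change their product.
  x^q≈x : ∀ x → x ^ q ≈ x
  x^q≈x x with x ≟ 0#
  ... | yes x≈0 = trans (^-congˡ q x≈0) (trans (0^ 0<q) (sym x≈0))
  ... | no x≉0  = begin
    x ^ q             ≈⟨ product-except (index 0#) w (w-0 (enum-index 0#)) (λ j j≢ → w-≉0 (λ e → j≢ (≡.trans (≡.sym (index-enum j)) (index-cong e)))) ⟨
    x * Prod.sum w    ≈⟨ *-congˡ Πw≈1 ⟩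
    x * 1#            ≈⟨ *-identityʳ x ⟩
    x                 ∎
    where
    y = proj₁ (inv x x≉0)
    xy≈1 = proj₂ (inv x x≉0)
    -- The products run over all of `Fin q`, so the zero element has to contribute a unit: `h` keeps
    -- nonzero elements, `w` has the factor x in their places, and both give 1 at zero.
    pick : Carrier → ∀ {z} → Dec (z ≈ 0#) → Carrier
    pick u (yes _) = 1#
    pick u (no _)  = u
    h : Carrier → Carrier
    h z = pick z (z ≟ 0#)
    w : Fin q → Carrier
    w i = pick x (enum i ≟ 0#)
    h-0 : ∀ {z} → z ≈ 0# → h z ≈ 1#
    h-0 {z} e with z ≟ 0#
    ... | yes _ = refl
    ... | no ¬e = contradiction e ¬e
    h-≉0 : ∀ {z} → ¬ z ≈ 0# → h z ≈ z
    h-≉0 {z} ¬e with z ≟ 0#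
    ... | yes e = contradiction e ¬e
    ... | no _ = refl
    w-0 : ∀ {i} → enum i ≈ 0# → w i ≈ 1#
    w-0 {i} e with enum i ≟ 0#
    ... | yes _ = refl
    ... | no ¬e = contradiction e ¬e
    w-≉0 : ∀ {i} → ¬ enum i ≈ 0# → w i ≈ x
    w-≉0 {i} ¬e with enum i ≟ 0#
    ... | yes e = contradiction e ¬e
    ... | no _ = refl
    h-nonzero : ∀ z → ¬ h z ≈ 0#
    h-nonzero z with z ≟ 0#
    ... | yes _ = 0≉1 ∘ sym
    ... | no ¬e = ¬e
    h-cong : ∀ {u v} → u ≈ v → h u ≈ h v
    h-cong {u} {v} e = case (u ≟ 0#) of λ where
      (yes u≈0) → trans (h-0 u≈0) (sym (h-0 (trans (sym e) u≈0)))
      (no u≉0)  → trans (h-≉0 u≉0) (trans e (sym (h-≉0 (u≉0 ∘ trans e))))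
    wh : ∀ i → w i * h (enum i) ≈ h (x * enum i)
    wh i = case (enum i ≟ 0#) of λ where
      (yes e) → trans (*-cong (w-0 e) (h-0 e)) (trans (*-identityˡ 1#) (sym (h-0 (trans (*-congˡ e) (zeroʳ x)))))
      (no ¬e) → trans (*-cong (w-≉0 ¬e) (h-≉0 ¬e)) (sym (h-≉0 (*-≉0 x≉0 ¬e)))
    π = permute (x *_) (y *_) *-congˡ *-congˡ
          (λ z → trans (sym (*-assoc x y z)) (trans (*-congʳ xy≈1) (*-identityˡ z)))
          (λ z → trans (sym (*-assoc y x z)) (trans (*-congʳ (trans (*-comm y x) xy≈1)) (*-identityˡ z)))
    Πh = Prod.sum (h ∘ enum)
    Πw≈1 : Prod.sum w ≈ 1#
    Πw≈1 = *-cancelˡ-≉0 (product-≉0 (h ∘ enum) (h-nonzero ∘ enum)) (begin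
      Πh * Prod.sum w                          ≈⟨ *-comm Πh _ ⟩
      Prod.sum w * Πh                          ≈⟨ Prod.∑-distrib-+ w (h ∘ enum) ⟨
      Prod.sum (λ i → w i * h (enum i))        ≈⟨ Prod.sum-cong-≋ wh ⟩
      Prod.sum (λ i → h (x * enum i))          ≈⟨ Prod.sum-cong-≋ (λ i → h-cong (enum-index (x * enum i))) ⟨
      Prod.sum (λ i → h (enum (π ⟨$⟩ʳ i)))     ≈⟨ Prod.sum-permute (h ∘ enum) π ⟨
      Πh                                       ≈⟨ *-identityʳ Πh ⟨
      Πh * 1#                                  ∎)

  ^-·1 : ∀ m n → (m ℕ.^ n) · 1# ≈ (m · 1#) ^ n
  ^-·1 m zero    = +-identityʳ 1#
  ^-·1 m (suc n) = trans (×1-homo-* m (m ℕ.^ n)) (*-congˡ (^-·1 m n))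

  -- A field has no nonzero nilpotent element, and the n-th power of p · 1 is q · 1 = 0.
  characteristic : ∀ {p} n → q ≡ p ℕ.^ n → p · 1# ≈ 0#
  characteristic {p} n q≡pⁿ = ^-≈0 (p · 1#) n (begin
    (p · 1#) ^ n     ≈⟨ ^-·1 p n ⟨
    (p ℕ.^ n) · 1#   ≡⟨ ≡.cong (_· 1#) q≡pⁿ ⟨
    q · 1#           ≈⟨ q·x≈0 1# ⟩
    0#               ∎)

  multiple-≈0 : ∀ {p m} → p · 1# ≈ 0# → p ∣ m → ∀ x → m · x ≈ 0#
  multiple-≈0 {p} p≈0 (divides k ≡.refl) x = begin
    (k ℕ.* p) · x            ≈⟨ ×-congʳ (k ℕ.* p) (*-identityˡ x) ⟨
    (k ℕ.* p) · (1# * x)     ≈⟨ ×-assoc-* (k ℕ.* p) 1# x ⟨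
    ((k ℕ.* p) · 1#) * x     ≈⟨ *-congʳ (trans (×1-homo-* k p) (trans (*-congˡ p≈0) (zeroʳ _))) ⟩
    0# * x                   ≈⟨ zeroˡ x ⟩
    0#                       ∎

  -- In the binomial expansion every inner coefficient is a multiple of p and vanishes; only the two
  -- outer terms survive.
  frobenius : ∀ {p} → Prime p → p · 1# ≈ 0# → ∀ x y → (x + y) ^ p ≈ x ^ p + y ^ p
  frobenius {zero}      pr = ⊥-elim (ℕ.≢-nonZero⁻¹ 0 {{prime⇒nonZero pr}} ≡.refl)
  frobenius {p@(suc m)} pr p≈0 x y = begin
    (x + y) ^ p                                    ≈⟨ Binomial.theorem commutativeSemiring p x y ⟩
    t Fin.zero + Sum.sum (t ∘ Fin.suc)             ≈⟨ +-congˡ (Sum.sum-init-last (t ∘ Fin.suc)) ⟩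
    t Fin.zero + (Sum.sum (t ∘ Fin.suc ∘ inject₁) + t (fromℕ p))
                                                   ≈⟨ +-cong first (+-cong (trans (Sum.sum-cong-≋ middle) (Sum.sum-replicate-zero m)) last) ⟩
    y ^ p + (0# + x ^ p)                           ≈⟨ solve 2 (λ a b → b :+ (:0 :+ a) := a :+ b) refl (x ^ p) (y ^ p) ⟩
    x ^ p + y ^ p                                  ∎
    where
    t = Binomial.binomialTerm commutativeSemiring x y p
    first : t Fin.zero ≈ y ^ p
    first = trans (+-identityʳ _) (*-identityˡ _)
    last : t (fromℕ p) ≈ x ^ p
    last rewrite Fin.toℕ-fromℕ m | nCn≡1 p | ℕ.n∸n≡0 m = trans (+-identityʳ _) (*-identityʳ _)
    middle : ∀ i → t (Fin.suc (inject₁ i)) ≈ 0#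
    middle i = multiple-≈0 p≈0 (prime∣C pr (s≤s z≤n) (s≤s (≡.subst (_< m) (≡.sym (Fin.toℕ-inject₁ i)) (Fin.toℕ<n i)))) _

  frobenius^ : ∀ {p} → Prime p → p · 1# ≈ 0# → ∀ k x y → (x + y) ^ (p ℕ.^ k) ≈ x ^ (p ℕ.^ k) + y ^ (p ℕ.^ k)
  frobenius^ pr p≈0 zero    x y = trans (*-identityʳ _) (+-cong (sym (*-identityʳ x)) (sym (*-identityʳ y)))
  frobenius^ {p} pr p≈0 (suc k) x y = begin
    (x + y) ^ (p ℕ.* p ℕ.^ k)                       ≈⟨ ^-assocʳ (x + y) p (p ℕ.^ k) ⟨
    ((x + y) ^ p) ^ (p ℕ.^ k)                       ≈⟨ ^-congˡ (p ℕ.^ k) (frobenius pr p≈0 x y) ⟩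
    (x ^ p + y ^ p) ^ (p ℕ.^ k)                     ≈⟨ frobenius^ pr p≈0 k (x ^ p) (y ^ p) ⟩
    (x ^ p) ^ (p ℕ.^ k) + (y ^ p) ^ (p ℕ.^ k)       ≈⟨ +-cong (^-assocʳ x p (p ℕ.^ k)) (^-assocʳ y p (p ℕ.^ k)) ⟩
    x ^ (p ℕ.* p ℕ.^ k) + y ^ (p ℕ.* p ℕ.^ k)       ∎

  -- Lengthening needs exactly three columns: distinct indices make the Vandermonde matrix
  -- invertible, and a nonzero coefficient can be divided out of the prescribed contribution of its
  -- column.
  record Triple {J : Set} {r} (h : J → Fin r → Carrier) (v : Fin r → Carrier) : Set (c ⊔ ℓ) where
    constructor triple
    field
      {j₁ j₂ j₃} : J
      j₁≢j₂      : j₁ ≢ j₂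
      j₁≢j₃      : j₁ ≢ j₃
      j₂≢j₃      : j₂ ≢ j₃
      {c₁ c₂ c₃} : Carrier
      c₁≉0       : ¬ c₁ ≈ 0#
      c₂≉0       : ¬ c₂ ≈ 0#
      c₃≉0       : ¬ c₃ ≈ 0#
      combination : ∀ i → c₁ * h j₁ i + c₂ * h j₂ i + c₃ * h j₃ i ≈ v i

  -- The list a₀ ∷ … ∷ aₙ₋₁ ∷ [] denotes the monic polynomial a₀ + a₁ x + … + aₙ₋₁ xⁿ⁻¹ + xⁿ.
  ⟦_⟧ : List Carrier → Carrier → Carrier
  ⟦ [] ⟧     x = 1#
  ⟦ a ∷ as ⟧ x = a + x * ⟦ as ⟧ x

  -- Horner's scheme: for every a, `quotient r as` is the quotient of `a ∷ as` by x - r, which does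
  -- not depend on the constant term a.
  quotient : Carrier → List Carrier → List Carrier
  quotient r []       = []
  quotient r (a ∷ as) = ⟦ a ∷ as ⟧ r ∷ quotient r as

  length-quotient : ∀ r as → length (quotient r as) ≡ length as
  length-quotient r []       = ≡.refl
  length-quotient r (a ∷ as) = ≡.cong suc (length-quotient r as)

  factor : ∀ r a as x → ⟦ a ∷ as ⟧ x ≈ ⟦ a ∷ as ⟧ r + (x - r) * ⟦ quotient r as ⟧ x
  factor r a []       x = solve 3 (λ r a x → a :+ x :* :1 := a :+ r :* :1 :+ (x :- r) :* :1) refl r a x
  factor r a (b ∷ as) x = trans (+-congˡ (*-congˡ (factor r b as x)))
    (solve 5 (λ r a x e e′ → a :+ x :* (e :+ (x :- r) :* e′) := a :+ r :* e :+ (x :- r) :* (e :+ x :* e′)) refl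
      r a x (⟦ b ∷ as ⟧ r) (⟦ quotient r as ⟧ x))

  -- The leading coefficient is implicit, so the length of the list is the degree and the empty list
  -- is the rootless constant 1. After division by x - r with r the first root, the other roots
  -- remain roots, since they differ from r.
  #roots≤degree : ∀ as {n} (f : Fin n → Carrier) → Injective _≡_ _≈_ f → (∀ i → ⟦ as ⟧ (f i) ≈ 0#) → n ≤ length as
  #roots≤degree as       {zero}  f f-inj f-root = z≤n
  #roots≤degree []       {suc n} f f-inj f-root = contradiction (sym (f-root Fin.zero)) 0≉1
  #roots≤degree (a ∷ as) {suc n} f f-inj f-root = s≤s (≡.subst (n ≤_) (length-quotient r as)
    (#roots≤degree (quotient r as) (f ∘ Fin.suc) (Fin.suc-injective ∘ f-inj) λ i →
      *-cancel-≉0 {f (Fin.suc i) - r} (λ e → case f-inj (x-y≈0⇒x≈y _ _ e) of λ ()) (begin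
        (f (Fin.suc i) - r) * ⟦ quotient r as ⟧ (f (Fin.suc i))
          ≈⟨ +-identityˡ _ ⟨
        0# + (f (Fin.suc i) - r) * ⟦ quotient r as ⟧ (f (Fin.suc i))
          ≈⟨ +-congʳ (f-root Fin.zero) ⟨
        ⟦ a ∷ as ⟧ r + (f (Fin.suc i) - r) * ⟦ quotient r as ⟧ (f (Fin.suc i))
          ≈⟨ factor r a as (f (Fin.suc i)) ⟨
        ⟦ a ∷ as ⟧ (f (Fin.suc i))
          ≈⟨ f-root (Fin.suc i) ⟩
        0# ∎)))
    where r = f Fin.zero

  shift : ℕ → List Carrier → List Carrier
  shift n as = replicate n 0# ++ as

  length-shift : ∀ n as → length (shift n as) ≡ n ℕ.+ length as
  length-shift n as = ≡.trans (length-++ (replicate n 0#)) (≡.cong (ℕ._+ length as) (length-replicate n))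

  ⟦shift⟧ : ∀ n as x → ⟦ shift n as ⟧ x ≈ x ^ n * ⟦ as ⟧ x
  ⟦shift⟧ zero    as x = sym (*-identityˡ _)
  ⟦shift⟧ (suc n) as x = trans (+-identityˡ _) (trans (*-congˡ (⟦shift⟧ n as x)) (sym (*-assoc _ _ _)))

  -- X^(d+1) − X for d > 0
  frobeniusPoly : ℕ → List Carrier
  frobeniusPoly zero    = []
  frobeniusPoly (suc d) = 0# ∷ - 1# ∷ shift d []

  length-frobeniusPoly : ∀ d → 0 < d → length (frobeniusPoly d) ≡ suc d
  length-frobeniusPoly (suc d) _ = ≡.cong (suc ∘ suc) (≡.trans (length-shift d []) (ℕ.+-identityʳ d))

  ⟦frobeniusPoly⟧ : ∀ d → 0 < d → ∀ x → ⟦ frobeniusPoly d ⟧ x ≈ x ^ suc d - x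
  ⟦frobeniusPoly⟧ (suc d) _ x = trans (+-congˡ (*-congˡ (+-congˡ (*-congˡ (⟦shift⟧ d [] x)))))
    (solve 2 (λ x y → :0 :+ x :* (:- :1 :+ x :* (y :* :1)) := x :* (x :* y) :- x) refl x (x ^ d))

  -- 1 + X^d + … + X^(n d) for d > 0
  geometricPoly : ℕ → ℕ → List Carrier
  geometricPoly d zero    = []
  geometricPoly d (suc n) = 1# ∷ shift (ℕ.pred d) (geometricPoly d n)

  length-geometricPoly : ∀ d → 0 < d → ∀ n → length (geometricPoly d n) ≡ n ℕ.* d
  length-geometricPoly (suc d) _   zero    = ≡.refl
  length-geometricPoly (suc d) 0<d (suc n) = ≡.cong suc (≡.trans (length-shift d _) (≡.cong (d ℕ.+_) (length-geometricPoly (suc d) 0<d n)))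

  ⟦geometricPoly⟧ : ∀ d → 0 < d → ∀ n x → (x ^ d - 1#) * ⟦ geometricPoly d n ⟧ x ≈ (x ^ d) ^ suc n - 1#
  ⟦geometricPoly⟧ d       0<d zero    x = solve 1 (λ y → (y :- :1) :* :1 := y :* :1 :- :1) refl (x ^ d)
  ⟦geometricPoly⟧ (suc d) 0<d (suc n) x = begin
    (y - 1#) * (1# + x * ⟦ shift d g ⟧ x)         ≈⟨ *-congˡ (+-congˡ (*-congˡ (⟦shift⟧ d g x))) ⟩
    (y - 1#) * (1# + x * (x ^ d * ⟦ g ⟧ x))       ≈⟨ solve 3 (λ x z g → let y = x :* z in (y :- :1) :* (:1 :+ x :* (z :* g)) := y :- :1 :+ y :* ((y :- :1) :* g)) refl x (x ^ d) (⟦ g ⟧ x) ⟩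
    y - 1# + y * ((y - 1#) * ⟦ g ⟧ x)             ≈⟨ +-congˡ (*-congˡ (⟦geometricPoly⟧ (suc d) 0<d n x)) ⟩
    y - 1# + y * (y ^ suc n - 1#)                 ≈⟨ solve 2 (λ y z → y :- :1 :+ y :* (z :- :1) := y :* z :- :1) refl y (y ^ suc n) ⟩
    y ^ suc (suc n) - 1#                          ∎
    where
    y = x ^ suc d
    g = geometricPoly (suc d) n

-- The subfield of order Q

-- The factorisation Q³ - 1 = (Q - 1)(Q² + Q + 1), with the last factor written as `suc e` for e =
-- Q² + Q, the form in which `Q≤#K` takes it.
cube-suc : ∀ d → suc d ℕ.^ 3 ≡ 1 ℕ.+ d ℕ.* suc (suc d ℕ.* suc d ℕ.+ suc d)
cube-suc = ℕ-solve 1 (λ d → let Q = ℕ-con 1 ⊕ d in Q ⊗ (Q ⊗ (Q ⊗ ℕ-con 1)) ⊜ ℕ-con 1 ⊕ d ⊗ (ℕ-con 1 ⊕ (Q ⊗ Q ⊕ Q))) ≡.refl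

module Subfield {c ℓ : Level} {q : ℕ} (F : FiniteField c ℓ q) (p k d : ℕ) (p-prime : Prime p) (0<d : 0 < d)
                (Q≡pᵏ : suc d ≡ p ℕ.^ k) (q≡Q³ : q ≡ suc d ℕ.^ 3) where
  open FieldTheory F public
  private module ≈-Reasoning = SetoidReasoning setoid

  Q : ℕ
  Q = suc d

  InK : Carrier → Set ℓ
  InK x = x ^ Q ≈ x

  K-resp : ∀ {x y} → x ≈ y → InK x → InK y
  K-resp e x∈ = trans (^-congˡ Q (sym e)) (trans x∈ e)

  [x+y]^Q : ∀ x y → (x + y) ^ Q ≈ x ^ Q + y ^ Q
  [x+y]^Q x y = ≡.subst (λ n → (x + y) ^ n ≈ x ^ n + y ^ n) (≡.sym Q≡pᵏ)
    (frobenius^ p-prime (characteristic (k ℕ.* 3) (≡.trans q≡Q³ (≡.trans (≡.cong (ℕ._^ 3) Q≡pᵏ) (ℕ.^-*-assoc p k 3)))) k x y)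

  0∈K : InK 0#
  0∈K = zeroˡ _

  1∈K : InK 1#
  1∈K = 1^ Q

  +∈K : ∀ {x y} → InK x → InK y → InK (x + y)
  +∈K x∈ y∈ = trans ([x+y]^Q _ _) (+-cong x∈ y∈)

  *∈K : ∀ {x y} → InK x → InK y → InK (x * y)
  *∈K x∈ y∈ = trans (^-distrib-* _ _ Q) (*-cong x∈ y∈)

  -- Derived from additivity of the Q-th power instead of the parity of Q, so that characteristic 2
  -- is no special case.
  -∈K : ∀ {x} → InK x → InK (- x)
  -∈K {x} x∈ = let open ≈-Reasoning in begin
    (- x) ^ Q                   ≈⟨ solve 2 (λ x y → y := (x :+ y) :- x) refl x ((- x) ^ Q) ⟩
    x + (- x) ^ Q - x           ≈⟨ +-congʳ (+-congʳ x∈) ⟨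
    x ^ Q + (- x) ^ Q - x       ≈⟨ +-congʳ ([x+y]^Q x (- x)) ⟨
    (x - x) ^ Q - x             ≈⟨ +-congʳ (trans (^-congˡ Q (-‿inverseʳ x)) 0∈K) ⟩
    0# - x                      ≈⟨ +-identityˡ (- x) ⟩
    - x                         ∎

  sub∈K : ∀ {x y} → InK x → InK y → InK (x - y)
  sub∈K x∈ y∈ = +∈K x∈ (-∈K y∈)

  inv∈K : ∀ {x y} → x * y ≈ 1# → InK x → InK y
  inv∈K {x} {y} xy≈1 x∈ = *-cancelˡ-≉0 x≉0 (let open ≈-Reasoning in begin
    x * y ^ Q       ≈⟨ *-congʳ x∈ ⟨
    x ^ Q * y ^ Q   ≈⟨ ^-distrib-* x y Q ⟨
    (x * y) ^ Q     ≈⟨ ^-congˡ Q xy≈1 ⟩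
    1# ^ Q          ≈⟨ 1∈K ⟩
    1#              ≈⟨ xy≈1 ⟨
    x * y           ∎)
    where
    x≉0 : ¬ x ≈ 0#
    x≉0 e = 0≉1 (trans (sym (zeroˡ y)) (trans (*-congʳ (sym e)) xy≈1))

  -- x^(Q³−1) = 1 for x ≠ 0, and Y^(e+1) − 1 = (Y − 1)(1 + Y + … + Y^e) with Y = x^d.
  ∉K⇒root : ∀ e → q ≡ suc (d ℕ.* suc e) → ∀ x → ¬ InK x → ⟦ geometricPoly d e ⟧ x ≈ 0#
  ∉K⇒root e q≡ x x∉ = *-cancel-≉0 (λ y≈1 → x∉ (trans (*-congˡ (x-y≈0⇒x≈y _ _ y≈1)) (*-identityʳ x))) (let open ≈-Reasoning in begin
    (x ^ d - 1#) * ⟦ geometricPoly d e ⟧ x   ≈⟨ ⟦geometricPoly⟧ d 0<d e x ⟩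
    (x ^ d) ^ suc e - 1#                     ≈⟨ x≈y⇒x-y≈0 (*-cancelˡ-≉0 x≉0 (begin
      x * (x ^ d) ^ suc e                      ≈⟨ *-congˡ (^-assocʳ x d (suc e)) ⟩
      x ^ suc (d ℕ.* suc e)                    ≈⟨ ^-congʳ x q≡ ⟨
      x ^ q                                    ≈⟨ x^q≈x x ⟩
      x                                        ≈⟨ *-identityʳ x ⟨
      x * 1#                                   ∎)) ⟩
    0#                                       ∎)
    where
    x≉0 : ¬ x ≈ 0#
    x≉0 e = x∉ (K-resp (sym e) 0∈K)

  private
    S : Split (InK ∘ enum)
    S = split (λ i → enum i ^ Q ≟ enum i)
    module S = Split S

  #K≤Q : S.#in ≤ Q
  #K≤Q = ≡.subst (S.#in ≤_) (length-frobeniusPoly d 0<d)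
    (#roots≤degree (frobeniusPoly d) (enum ∘ S.inside) (S.inside-inj ∘ enum-injective)
      (λ i → trans (⟦frobeniusPoly⟧ d 0<d _) (x≈y⇒x-y≈0 (S.inside-∈ i))))

  -- The elements outside K are roots of a polynomial of degree e d = q - Q, so at least Q elements
  -- are left for K.
  Q≤#K : ∀ e → q ≡ suc (d ℕ.* suc e) → Q ≤ S.#in
  Q≤#K e q≡ = ℕ.+-cancelʳ-≤ (e ℕ.* d) Q S.#in (let open ℕ.≤-Reasoning in begin
    Q ℕ.+ e ℕ.* d        ≡⟨ ≡.cong suc (≡.cong (d ℕ.+_) (ℕ.*-comm e d)) ⟩
    suc (d ℕ.+ d ℕ.* e)  ≡⟨ ≡.cong suc (ℕ.*-suc d e) ⟨
    suc (d ℕ.* suc e)    ≡⟨ q≡ ⟨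
    q                    ≡⟨ S.total ⟨
    S.#in ℕ.+ S.#out     ≤⟨ ℕ.+-monoʳ-≤ S.#in (≡.subst (S.#out ≤_) (length-geometricPoly d 0<d e)
        (#roots≤degree (geometricPoly d e) (enum ∘ S.outside) (S.outside-inj ∘ enum-injective)
          (λ i → ∉K⇒root e q≡ _ (S.outside-∉ i)))) ⟩
    S.#in ℕ.+ e ℕ.* d    ∎)

  #K≡Q : S.#in ≡ Q
  #K≡Q = ℕ.≤-antisym #K≤Q (Q≤#K (Q ℕ.* Q ℕ.+ Q) (≡.trans q≡Q³ (cube-suc d)))

  abstract
    κ : Fin Q → Carrier
    κ = enum ∘ S.inside ∘ Fin.cast (≡.sym #K≡Q)

    κ∈K : ∀ i → InK (κ i)
    κ∈K i = S.inside-∈ _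

    κ-injective : ∀ {i j} → κ i ≈ κ j → i ≡ j
    κ-injective {i} {j} e = Fin.toℕ-injective (≡.trans (≡.sym (Fin.toℕ-cast _ i))
      (≡.trans (≡.cong toℕ (S.inside-inj (enum-injective e))) (Fin.toℕ-cast _ j)))

    κ-onto : ∀ {x} → InK x → ∃ λ i → κ i ≈ x
    κ-onto {x} x∈ = let i , e = S.inside-onto (index x) (K-resp (sym (enum-index x)) x∈) in
      Fin.cast #K≡Q i ,
      trans (reflexive (≡.cong enum (≡.trans (≡.cong S.inside
        (≡.trans (Fin.cast-trans #K≡Q (≡.sym #K≡Q) i) (Fin.cast-is-id ≡.refl i))) e))) (enum-index x)

  -- x ↦ x² − x identifies 0 and 1, so it cannot be onto K.
  non-norm : Σ Carrier λ m → InK m × (∀ x → InK x → ¬ x * x - x ≈ m)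
  non-norm with Fin.all? (λ j → Fin.any? (λ i → κ i * κ i - κ i ≟ κ j))
  ... | no ¬onto = let j , no-root = Fin.¬∀⟶∃¬ Q _ (λ j → Fin.any? (λ i → κ i * κ i - κ i ≟ κ j)) ¬onto in
    κ j , κ∈K j , λ x x∈ e → let i , κi≈x = κ-onto x∈ in
      no-root (i , trans (+-cong (*-cong κi≈x κi≈x) (-‿cong κi≈x)) e)
  ... | yes root = contradiction (Fin.injective⇒≤ {f = g} g-injective) ℕ.1+n≰n
    where
    r : Fin Q → Fin Q
    r j = proj₁ (root j)
    r-root : ∀ j → κ (r j) * κ (r j) - κ (r j) ≈ κ j
    r-root j = proj₂ (root j)
    -- Here x is the preimage of 0 selected by `r`, and 1 - x is a second preimage. Were it selected
    -- too, x = 1 - x would follow, which x² = x rules out; so `other` extends the injection `r` by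
    -- one more element.
    zero∃ = κ-onto 0∈K
    o = proj₁ zero∃
    x = κ (r o)
    x²-x≈0 : x * x - x ≈ 0#
    x²-x≈0 = trans (r-root o) (proj₂ zero∃)
    other∃ = κ-onto {1# - x} (sub∈K 1∈K (κ∈K (r o)))
    other = proj₁ other∃
    r-injective : ∀ {i j} → r i ≡ r j → i ≡ j
    r-injective {i} {j} e = κ-injective (trans (sym (r-root i))
      (trans (reflexive (≡.cong (λ s → κ s * κ s - κ s) e)) (r-root j)))
    other∉r : ∀ j → other ≢ r j
    other∉r j e = 0≉1 (let open ≈-Reasoning in begin
      0#              ≈⟨ x≈0 ⟨
      x               ≈⟨ x≈1-x ⟩
      1# - x          ≈⟨ +-congˡ (-‿cong x≈0) ⟩
      1# - 0#         ≈⟨ solve 0 (:1 :- :0 := :1) refl ⟩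
      1#              ∎)
      where
      rj≈ : κ (r j) ≈ 1# - x
      rj≈ = trans (reflexive (≡.cong κ (≡.sym e))) (proj₂ other∃)
      j≡o : j ≡ o
      j≡o = κ-injective (let open ≈-Reasoning in begin
        κ j                                  ≈⟨ r-root j ⟨
        κ (r j) * κ (r j) - κ (r j)          ≈⟨ +-cong (*-cong rj≈ rj≈) (-‿cong rj≈) ⟩
        (1# - x) * (1# - x) - (1# - x)       ≈⟨ solve 1 (λ x → (:1 :- x) :* (:1 :- x) :- (:1 :- x) := x :* x :- x) refl x ⟩
        x * x - x                            ≈⟨ x²-x≈0 ⟩
        0#                                   ≈⟨ proj₂ zero∃ ⟨
        κ o                                  ∎)
      x≈1-x : x ≈ 1# - x
      x≈1-x = trans (reflexive (≡.cong (κ ∘ r) (≡.sym j≡o))) rj≈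
      x≈0 : x ≈ 0#
      x≈0 = let open ≈-Reasoning in begin
        x                       ≈⟨ solve 1 (λ x → x := x :* (x :+ x) :- (x :* x :- x) :- x :* x) refl x ⟩
        x * (x + x) - (x * x - x) - x * x
                                ≈⟨ +-congʳ (+-congʳ (*-congˡ (trans (+-congˡ x≈1-x) (solve 1 (λ x → x :+ (:1 :- x) := :1) refl x)))) ⟩
        x * 1# - (x * x - x) - x * x
                                ≈⟨ solve 1 (λ x → x :* :1 :- (x :* x :- x) :- x :* x := :- (x :* x :- x) :- (x :* x :- x)) refl x ⟩
        - (x * x - x) - (x * x - x)
                                ≈⟨ +-cong (-‿cong x²-x≈0) (-‿cong x²-x≈0) ⟩
        - 0# - 0#               ≈⟨ solve 0 (:- :0 :- :0 := :0) refl ⟩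
        0#                      ∎
    g : Fin (suc Q) → Fin Q
    g Fin.zero    = other
    g (Fin.suc j) = r j
    g-injective : Injective _≡_ _≡_ g
    g-injective {Fin.zero}  {Fin.zero}  e = ≡.refl
    g-injective {Fin.zero}  {Fin.suc j} e = contradiction e (other∉r j)
    g-injective {Fin.suc i} {Fin.zero}  e = contradiction (≡.sym e) (other∉r i)
    g-injective {Fin.suc i} {Fin.suc j} e = ≡.cong Fin.suc (r-injective e)

-- Four lines without a transversal

funToFin-cong : ∀ {m n} {f g : Fin m → Fin n} → (∀ i → f i ≡ g i) → funToFin f ≡ funToFin g
funToFin-cong {zero}  e = ≡.refl
funToFin-cong {suc m} e = ≡.cong₂ Fin.combine (e 0F) (funToFin-cong (e ∘ Fin.suc))

finToFun-injective : ∀ {m n} {i j : Fin (n ℕ.^ m)} → (∀ k → finToFun {n} {m} i k ≡ finToFun j k) → i ≡ j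
finToFun-injective {m} {n} {i} {j} e = ≡.trans (≡.sym (Fin.funToFin-finToFin {m} {n} i))
  (≡.trans (funToFin-cong e) (Fin.funToFin-finToFin {m} {n} j))

module Lines {c ℓ : Level} {q : ℕ} (F : FiniteField c ℓ q) (p k d : ℕ) (p-prime : Prime p) (0<d : 0 < d)
             (Q≡pᵏ : suc d ≡ p ℕ.^ k) (q≡Q³ : q ≡ suc d ℕ.^ 3) (4≤q : 4 ≤ q) where
  open Subfield F p k d p-prime 0<d Q≡pᵏ q≡Q³ public
  open SetoidReasoning setoid

  m : Carrier
  m = proj₁ non-norm

  m∈ : InK m
  m∈ = proj₁ (proj₂ non-norm)

  -- The lines {(x , 0)}, {(0 , x)}, {(x , x)}, {(x , A x)} of PG(3, Q) with x ∈ K² and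
  -- A (x₁ , x₂) = (m x₂ , x₁ + x₂). No line meets all four, because A has no eigenvector over K.
  A B : Fin 4 → Fin 4 → Carrier
  A 0F 0F = 1#
  A 1F 2F = 1#
  A 2F 0F = 1#
  A 2F 2F = 1#
  A 3F 0F = 1#
  A 3F 3F = 1#
  A _  _  = 0#
  B 0F 1F = 1#
  B 1F 3F = 1#
  B 2F 1F = 1#
  B 2F 3F = 1#
  B 3F 1F = 1#
  B 3F 2F = m
  B 3F 3F = 1#
  B _  _  = 0#

  line : Fin 4 → Carrier → Carrier → Fin 4 → Carrier
  line l x y i = x * A l i + y * B l i

  -- Homogeneous coordinates of the points of PG(1, Q).
  px py : Fin (suc Q) → Carrier
  px Fin.zero    = 0#
  px (Fin.suc j) = 1#
  py Fin.zero    = 1#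
  py (Fin.suc j) = κ j

  col : Fin 4 × Fin (suc Q) → Fin 4 → Carrier
  col (l , s) = line l (px s) (py s)

  -- A vector on one line has coordinates in F and need not be a multiple of a point over K.
  -- Spending exactly two columns of that line on it completes a third column from another line to a
  -- triple.
  record Pair (x y : Carrier) : Set (c ⊔ ℓ) where
    field
      {s₁ s₂} : Fin (suc Q)
      s₁≢s₂   : s₁ ≢ s₂
      {c₁ c₂} : Carrier
      c₁≉0    : ¬ c₁ ≈ 0#
      c₂≉0    : ¬ c₂ ≈ 0#
      x≈      : c₁ * px s₁ + c₂ * px s₂ ≈ x
      y≈      : c₁ * py s₁ + c₂ * py s₂ ≈ y

  -- The points (0 , 1), (1 , 0) and (1 , 1). A nonzero vector of F² is a multiple of at most one of
  -- them, so two of them always represent it with nonzero coefficients.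
  ∞ O I : Fin (suc Q)
  ∞ = Fin.zero
  O = Fin.suc (proj₁ (κ-onto 0∈K))
  I = Fin.suc (proj₁ (κ-onto 1∈K))

  py-O : py O ≈ 0#
  py-O = proj₂ (κ-onto 0∈K)

  py-I : py I ≈ 1#
  py-I = proj₂ (κ-onto 1∈K)

  O≢I : O ≢ I
  O≢I e = 0≉1 (trans (sym py-O) (trans (reflexive (≡.cong py e)) py-I))

  -‿≉0 : ∀ {x} → ¬ x ≈ 0# → ¬ - x ≈ 0#
  -‿≉0 {x} x≉0 e = x≉0 (trans (solve 1 (λ x → x := :- (:- x)) refl x) (trans (-‿cong e) -0#≈0#))

  pair : ∀ x y → ¬ (x ≈ 0# × y ≈ 0#) → Pair x y
  pair x y xy≉0 with x ≟ 0# | y ≟ 0#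
  ... | yes x≈0 | yes y≈0 = contradiction (x≈0 , y≈0) xy≉0
  ... | yes x≈0 | no y≉0 = record
    { s₁ = I ; s₂ = O ; s₁≢s₂ = O≢I ∘ ≡.sym ; c₁≉0 = y≉0 ; c₂≉0 = -‿≉0 y≉0
    ; x≈ = trans (solve 1 (λ y → y :* :1 :+ (:- y) :* :1 := :0) refl y) (sym x≈0)
    ; y≈ = trans (+-cong (*-congˡ py-I) (*-congˡ py-O)) (solve 1 (λ y → y :* :1 :+ (:- y) :* :0 := y) refl y) }
  ... | no x≉0 | yes y≈0 = record
    { s₁ = ∞ ; s₂ = I ; s₁≢s₂ = λ () ; c₁≉0 = -‿≉0 x≉0 ; c₂≉0 = x≉0
    ; x≈ = solve 1 (λ x → (:- x) :* :0 :+ x :* :1 := x) refl x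
    ; y≈ = trans (+-congˡ (*-congˡ py-I)) (trans (solve 1 (λ x → (:- x) :* :1 :+ x :* :1 := :0) refl x) (sym y≈0)) }
  ... | no x≉0 | no y≉0 = record
    { s₁ = ∞ ; s₂ = O ; s₁≢s₂ = λ () ; c₁≉0 = y≉0 ; c₂≉0 = x≉0
    ; x≈ = solve 2 (λ x y → y :* :0 :+ x :* :1 := x) refl x y
    ; y≈ = trans (+-congˡ (*-congˡ py-O)) (solve 2 (λ x y → y :* :1 :+ x :* :0 := y) refl x y) }

  avoid : ∀ (f : Fin 3 → Carrier) → ∃ λ a → ∀ j → ¬ a ≈ f j
  avoid f with Fin.all? (λ i → Fin.any? (λ j → enum i ≟ f j))
  ... | no ¬hit = let i , i∉ = Fin.¬∀⟶∃¬ q _ (λ i → Fin.any? (λ j → enum i ≟ f j)) ¬hit in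
    enum i , λ j e → i∉ (j , e)
  ... | yes hit = contradiction (Fin.injective⇒≤ {f = proj₁ ∘ hit} λ {i} {j} e → enum-injective
      (trans (proj₂ (hit i)) (trans (reflexive (≡.cong f e)) (sym (proj₂ (hit j)))))) (ℕ.<⇒≱ 4≤q)

  -- (x , y) = α (1 , 1) + (x − α) (1 , 0) + (y − α) (0 , 1)
  onLine : ∀ l x y {v} → (∀ i → v i ≈ line l x y i) → Triple col v
  onLine l x y {v} v≈ = record
    { j₁ = l , I ; j₂ = l , O ; j₃ = l , ∞
    ; j₁≢j₂ = O≢I ∘ ≡.sym ∘ ≡.cong proj₂ ; j₁≢j₃ = λ () ; j₂≢j₃ = λ ()
    ; c₁≉0 = α∉ 0F
    ; c₂≉0 = λ e → α∉ 1F (sym (x-y≈0⇒x≈y _ _ e))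
    ; c₃≉0 = λ e → α∉ 2F (sym (x-y≈0⇒x≈y _ _ e))
    ; combination = λ i → begin
        α * col (l , I) i + (x - α) * col (l , O) i + (y - α) * col (l , ∞) i
          ≈⟨ +-congʳ (+-cong (*-congˡ (+-congˡ (*-congʳ py-I))) (*-congˡ (+-congˡ (*-congʳ py-O)))) ⟩
        α * (1# * A l i + 1# * B l i) + (x - α) * (1# * A l i + 0# * B l i) + (y - α) * (0# * A l i + 1# * B l i)
          ≈⟨ solve 5 (λ x y α a b → α :* (:1 :* a :+ :1 :* b) :+ (x :- α) :* (:1 :* a :+ :0 :* b) :+ (y :- α) :* (:0 :* a :+ :1 :* b) := x :* a :+ y :* b)
               refl x y α (A l i) (B l i) ⟩
        line l x y i
          ≈⟨ v≈ i ⟨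
        v i ∎
    }
    where
    excluded : Fin 3 → Carrier
    excluded 0F = 0#
    excluded 1F = x
    excluded 2F = y
    α = proj₁ (avoid excluded)
    α∉ = proj₂ (avoid excluded)

  line-*ˡ : ∀ l a x y i → line l (a * x) (a * y) i ≈ a * line l x y i
  line-*ˡ l a x y i = solve 5 (λ x y a α β → a :* x :* α :+ a :* y :* β := a :* (x :* α :+ y :* β)) refl x y a (A l i) (B l i)

  line-cong : ∀ l {x x′ y y′} → x ≈ x′ → y ≈ y′ → ∀ i → line l x y i ≈ line l x′ y′ i
  line-cong l e e′ i = +-cong (*-congʳ e) (*-congʳ e′)

  line-+ : ∀ l a b x y x′ y′ i → line l (a * x + b * x′) (a * y + b * y′) i ≈ a * line l x y i + b * line l x′ y′ i
  line-+ l a b x y x′ y′ i = solve 8 (λ a b x y x′ y′ α β → (a :* x :+ b :* x′) :* α :+ (a :* y :+ b :* y′) :* β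
    := a :* (x :* α :+ y :* β) :+ b :* (x′ :* α :+ y′ :* β)) refl a b x y x′ y′ (A l i) (B l i)

  -- If both parts are nonzero, `pair` splits the part on l into two columns. If one part vanishes,
  -- v lies on a single line and `onLine` finds three columns there.
  twoLines : ∀ {l l′} → l ≢ l′ → ∀ x y a s {v} → (∀ i → line l x y i + a * col (l′ , s) i ≈ v i) → Triple col v
  twoLines {l} {l′} l≢l′ x y a s {v} ≈v with a ≟ 0# | (x ≟ 0#) ×-dec (y ≟ 0#)
  ... | yes a≈0 | _ = onLine l x y λ i →
    trans (sym (≈v i)) (trans (+-congˡ (trans (*-congʳ a≈0) (zeroˡ _))) (+-identityʳ _))
  ... | no _ | yes (x≈0 , y≈0) = onLine l′ (a * px s) (a * py s) λ i → begin
    v i                                    ≈⟨ ≈v i ⟨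
    line l x y i + a * col (l′ , s) i      ≈⟨ +-congʳ (line-cong l x≈0 y≈0 i) ⟩
    line l 0# 0# i + a * col (l′ , s) i    ≈⟨ solve 3 (λ α β z → :0 :* α :+ :0 :* β :+ z := z) refl (A l i) (B l i) (a * col (l′ , s) i) ⟩
    a * col (l′ , s) i                     ≈⟨ line-*ˡ l′ a (px s) (py s) i ⟨
    line l′ (a * px s) (a * py s) i        ∎
  ... | no a≉0 | no xy≉0 = record
    { j₁ = l , P.s₁ ; j₂ = l , P.s₂ ; j₃ = l′ , s
    ; j₁≢j₂ = P.s₁≢s₂ ∘ ≡.cong proj₂ ; j₁≢j₃ = l≢l′ ∘ ≡.cong proj₁ ; j₂≢j₃ = l≢l′ ∘ ≡.cong proj₁
    ; c₁≉0 = P.c₁≉0 ; c₂≉0 = P.c₂≉0 ; c₃≉0 = a≉0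
    ; combination = λ i → begin
        P.c₁ * col (l , P.s₁) i + P.c₂ * col (l , P.s₂) i + a * col (l′ , s) i
          ≈⟨ +-congʳ (line-+ l P.c₁ P.c₂ _ _ _ _ i) ⟨
        line l (P.c₁ * px P.s₁ + P.c₂ * px P.s₂) (P.c₁ * py P.s₁ + P.c₂ * py P.s₂) i + a * col (l′ , s) i
          ≈⟨ +-congʳ (line-cong l P.x≈ P.y≈ i) ⟩
        line l x y i + a * col (l′ , s) i
          ≈⟨ ≈v i ⟩
        v i ∎ }
    where module P = Pair (pair x y xy≉0)

  threeLines : ∀ {l₁ l₂ l₃} → l₁ ≢ l₂ → l₁ ≢ l₃ → l₂ ≢ l₃ → ∀ c₁ c₂ c₃ s₁ s₂ s₃ {v} →
               (∀ i → c₁ * col (l₁ , s₁) i + c₂ * col (l₂ , s₂) i + c₃ * col (l₃ , s₃) i ≈ v i) → Triple col v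
  threeLines {l₁} {l₂} {l₃} l₁≢l₂ l₁≢l₃ l₂≢l₃ c₁ c₂ c₃ s₁ s₂ s₃ {v} ≈v with c₁ ≟ 0# | c₂ ≟ 0# | c₃ ≟ 0#
  ... | no c₁≉0 | no c₂≉0 | no c₃≉0 =
    triple {j₁ = l₁ , s₁} {j₂ = l₂ , s₂} {j₃ = l₃ , s₃} (l₁≢l₂ ∘ ≡.cong proj₁) (l₁≢l₃ ∘ ≡.cong proj₁) (l₂≢l₃ ∘ ≡.cong proj₁) c₁≉0 c₂≉0 c₃≉0 ≈v
  ... | yes c₁≈0 | _ | _ = twoLines l₂≢l₃ (c₂ * px s₂) (c₂ * py s₂) c₃ s₃ λ i → begin
    line l₂ (c₂ * px s₂) (c₂ * py s₂) i + c₃ * col (l₃ , s₃) i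
      ≈⟨ +-congʳ (line-*ˡ l₂ c₂ _ _ i) ⟩
    c₂ * col (l₂ , s₂) i + c₃ * col (l₃ , s₃) i
      ≈⟨ solve 3 (λ x y z → y :+ z := :0 :* x :+ y :+ z) refl (col (l₁ , s₁) i) _ _ ⟩
    0# * col (l₁ , s₁) i + c₂ * col (l₂ , s₂) i + c₃ * col (l₃ , s₃) i
      ≈⟨ +-congʳ (+-congʳ (*-congʳ c₁≈0)) ⟨
    c₁ * col (l₁ , s₁) i + c₂ * col (l₂ , s₂) i + c₃ * col (l₃ , s₃) i
      ≈⟨ ≈v i ⟩
    v i ∎
  ... | no _ | yes c₂≈0 | _ = twoLines l₁≢l₃ (c₁ * px s₁) (c₁ * py s₁) c₃ s₃ λ i → begin
    line l₁ (c₁ * px s₁) (c₁ * py s₁) i + c₃ * col (l₃ , s₃) i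
      ≈⟨ +-congʳ (line-*ˡ l₁ c₁ _ _ i) ⟩
    c₁ * col (l₁ , s₁) i + c₃ * col (l₃ , s₃) i
      ≈⟨ solve 3 (λ x y z → y :+ z := y :+ :0 :* x :+ z) refl (col (l₂ , s₂) i) _ _ ⟩
    c₁ * col (l₁ , s₁) i + 0# * col (l₂ , s₂) i + c₃ * col (l₃ , s₃) i
      ≈⟨ +-congʳ (+-congˡ (*-congʳ c₂≈0)) ⟨
    c₁ * col (l₁ , s₁) i + c₂ * col (l₂ , s₂) i + c₃ * col (l₃ , s₃) i
      ≈⟨ ≈v i ⟩
    v i ∎
  ... | no _ | no _ | yes c₃≈0 = twoLines l₁≢l₂ (c₁ * px s₁) (c₁ * py s₁) c₂ s₂ λ i → begin
    line l₁ (c₁ * px s₁) (c₁ * py s₁) i + c₂ * col (l₂ , s₂) i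
      ≈⟨ +-congʳ (line-*ˡ l₁ c₁ _ _ i) ⟩
    c₁ * col (l₁ , s₁) i + c₂ * col (l₂ , s₂) i
      ≈⟨ solve 3 (λ x y z → y :+ z := y :+ z :+ :0 :* x) refl (col (l₃ , s₃) i) _ _ ⟩
    c₁ * col (l₁ , s₁) i + c₂ * col (l₂ , s₂) i + 0# * col (l₃ , s₃) i
      ≈⟨ +-congˡ (*-congʳ c₃≈0) ⟨
    c₁ * col (l₁ , s₁) i + c₂ * col (l₂ , s₂) i + c₃ * col (l₃ , s₃) i
      ≈⟨ ≈v i ⟩
    v i ∎

  point : ∀ {x y} → InK x → InK y → ¬ (x ≈ 0# × y ≈ 0#) → ∃₂ λ s a → x ≈ a * px s × y ≈ a * py s
  point {x} {y} x∈ y∈ xy≉0 with x ≟ 0#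
  ... | yes x≈0 = ∞ , y , trans x≈0 (sym (zeroʳ y)) , sym (*-identityʳ y)
  ... | no x≉0  =
    let z , xz≈1 = inv x x≉0
        i , κi≈  = κ-onto (*∈K y∈ (inv∈K xz≈1 x∈))
    in Fin.suc i , x , sym (*-identityʳ x) , (begin
      y             ≈⟨ *-identityʳ y ⟨
      y * 1#        ≈⟨ *-congˡ xz≈1 ⟨
      y * (x * z)   ≈⟨ solve 3 (λ x y z → y :* (x :* z) := x :* (y :* z)) refl x y z ⟩
      x * (y * z)   ≈⟨ *-congˡ κi≈ ⟨
      x * κ i       ∎)

  -- The solutions (x , y) of g x + h y = 0 are the multiples of (− h , g).
  perp : ∀ {g h} → InK g → InK h → ¬ (g ≈ 0# × h ≈ 0#) → ∀ {x y} → g * x + h * y ≈ 0# →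
         ∃₂ λ s a → x ≈ a * px s × y ≈ a * py s
  perp {g} {h} g∈ h∈ gh≉0 {x} {y} gx+hy≈0 =
    let s , μ , -h≈ , g≈ = point (-∈K h∈) g∈ λ (-h≈0 , g≈0) → gh≉0 (g≈0 , trans (solve 1 (λ h → h := :- (:- h)) refl h) (trans (-‿cong -h≈0) -0#≈0#))
        a , x≈ , y≈      = multiple
    in s , a * μ , trans x≈ (trans (*-congˡ -h≈) (sym (*-assoc a μ _))) , trans y≈ (trans (*-congˡ g≈) (sym (*-assoc a μ _)))
    where
    multiple : ∃ λ a → x ≈ a * - h × y ≈ a * g
    multiple with g ≟ 0# | h ≟ 0#
    ... | yes g≈0 | yes h≈0 = contradiction (g≈0 , h≈0) gh≉0
    ... | no g≉0 | _ = let z , gz≈1 = inv g g≉0 in y * z ,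
      (begin
        x                                 ≈⟨ trans (*-congˡ gz≈1) (*-identityʳ x) ⟨
        x * (g * z)                       ≈⟨ solve 5 (λ g h x y z → x :* (g :* z) := z :* (g :* x :+ h :* y) :+ y :* z :* (:- h)) refl g h x y z ⟩
        z * (g * x + h * y) + y * z * - h ≈⟨ +-congʳ (trans (*-congˡ gx+hy≈0) (zeroʳ z)) ⟩
        0# + y * z * - h                  ≈⟨ +-identityˡ _ ⟩
        y * z * - h                       ∎) ,
      (begin
        y                                 ≈⟨ trans (*-congˡ gz≈1) (*-identityʳ y) ⟨
        y * (g * z)                       ≈⟨ solve 3 (λ g y z → y :* (g :* z) := y :* z :* g) refl g y z ⟩
        y * z * g                         ∎)
    ... | yes _ | no h≉0 = let z , hz≈1 = inv h h≉0 in - x * z ,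
      (begin
        x                                 ≈⟨ trans (*-congˡ hz≈1) (*-identityʳ x) ⟨
        x * (h * z)                       ≈⟨ solve 3 (λ h x z → x :* (h :* z) := (:- x) :* z :* (:- h)) refl h x z ⟩
        - x * z * - h                     ∎) ,
      (begin
        y                                 ≈⟨ trans (*-congˡ hz≈1) (*-identityʳ y) ⟨
        y * (h * z)                       ≈⟨ solve 5 (λ g h x y z → y :* (h :* z) := z :* (g :* x :+ h :* y) :+ (:- x) :* z :* g) refl g h x y z ⟩
        z * (g * x + h * y) + - x * z * g ≈⟨ +-congʳ (trans (*-congˡ gx+hy≈0) (zeroʳ z)) ⟩
        0# + - x * z * g                  ≈⟨ +-identityˡ _ ⟩
        - x * z * g                       ∎)

  -- F has only Q³ elements, so the Q⁴ combinations of v₀, …, v₃ with coefficients in K cannot be distinct.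
  annihilator : ∀ (v : Fin 4 → Carrier) → Σ (Fin 4 → Carrier) λ u → (∀ i → InK (u i)) × ¬ (∀ i → u i ≈ 0#) ×
                (u 0F * v 0F + u 1F * v 1F) + (u 2F * v 2F + u 3F * v 3F) ≈ 0#
  annihilator v with Fin.pigeonhole (≡.subst (ℕ._< Q ℕ.^ 4) (≡.sym q≡Q³) (ℕ.^-monoʳ-< Q (s≤s 0<d) (ℕ.n<1+n 3)))
                                    (index ∘ dot ∘ coords)
    where
    coords : Fin (Q ℕ.^ 4) → Fin 4 → Carrier
    coords w i = κ (finToFun {Q} {4} w i)
    dot : (Fin 4 → Carrier) → Carrier
    dot u = (u 0F * v 0F + u 1F * v 1F) + (u 2F * v 2F + u 3F * v 3F)
  ... | w , w′ , w<w′ , e = (λ i → a i - b i) , (λ i → sub∈K (κ∈K _) (κ∈K _)) ,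
    (λ u≈0 → Fin.<⇒≢ w<w′ (finToFun-injective {4} {Q} λ i → κ-injective (x-y≈0⇒x≈y _ _ (u≈0 i)))) ,
    trans (solve 12 (λ a₀ a₁ a₂ a₃ b₀ b₁ b₂ b₃ v₀ v₁ v₂ v₃ →
        ((a₀ :- b₀) :* v₀ :+ (a₁ :- b₁) :* v₁) :+ ((a₂ :- b₂) :* v₂ :+ (a₃ :- b₃) :* v₃)
        := ((a₀ :* v₀ :+ a₁ :* v₁) :+ (a₂ :* v₂ :+ a₃ :* v₃)) :- ((b₀ :* v₀ :+ b₁ :* v₁) :+ (b₂ :* v₂ :+ b₃ :* v₃)))
        refl (a 0F) (a 1F) (a 2F) (a 3F) (b 0F) (b 1F) (b 2F) (b 3F) (v 0F) (v 1F) (v 2F) (v 3F))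
      (x≈y⇒x-y≈0 (index-injective e))
    where
    a b : Fin 4 → Carrier
    a i = κ (finToFun {Q} {4} w i)
    b i = κ (finToFun {Q} {4} w′ i)

  halves : ∀ (v : Fin 4 → Carrier) i → line 0F (v 0F) (v 1F) i + line 1F (v 2F) (v 3F) i ≈ v i
  halves v 0F = solve 4 (λ a b c d → (a :* :1 :+ b :* :0) :+ (c :* :0 :+ d :* :0) := a) refl (v 0F) (v 1F) (v 2F) (v 3F)
  halves v 1F = solve 4 (λ a b c d → (a :* :0 :+ b :* :1) :+ (c :* :0 :+ d :* :0) := b) refl (v 0F) (v 1F) (v 2F) (v 3F)
  halves v 2F = solve 4 (λ a b c d → (a :* :0 :+ b :* :0) :+ (c :* :1 :+ d :* :0) := c) refl (v 0F) (v 1F) (v 2F) (v 3F)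
  halves v 3F = solve 4 (λ a b c d → (a :* :0 :+ b :* :0) :+ (c :* :0 :+ d :* :1) := d) refl (v 0F) (v 1F) (v 2F) (v 3F)

  -- A point P of the plane u = (f , g) on a further line with f · P ≠ 0 leaves a remainder v − a P
  -- whose halves are orthogonal to f and to g.
  thirdPoint : ∀ {f₁ f₂ g₁ g₂} → InK f₁ → InK f₂ → InK g₁ → InK g₂ → ¬ (f₁ ≈ 0# × f₂ ≈ 0#) → ¬ (g₁ ≈ 0# × g₂ ≈ 0#) →
               ∀ v → (f₁ * v 0F + f₂ * v 1F) + (g₁ * v 2F + g₂ * v 3F) ≈ 0# →
               ∀ l → 0F ≢ l → 1F ≢ l → ∀ {z₁ z₂} → InK z₁ → InK z₂ → (let P = line l z₁ z₂) →
               ¬ f₁ * P 0F + f₂ * P 1F ≈ 0# → (f₁ * P 0F + f₂ * P 1F) + (g₁ * P 2F + g₂ * P 3F) ≈ 0# → Triple col v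
  thirdPoint {f₁} {f₂} {g₁} {g₂} f₁∈ f₂∈ g₁∈ g₂∈ f≉0 g≉0 v uv≈0 l 0≢l 1≢l {z₁} {z₂} z₁∈ z₂∈ fP≉0 uP≈0 =
    assemble (perp f₁∈ f₂∈ f≉0 f·rest) (perp g₁∈ g₂∈ g≉0 g·rest) (point z₁∈ z₂∈ z≉0)
    where
    P = line l z₁ z₂
    z≉0 : ¬ (z₁ ≈ 0# × z₂ ≈ 0#)
    z≉0 (z₁≈0 , z₂≈0) = fP≉0 (begin
      f₁ * P 0F + f₂ * P 1F
        ≈⟨ +-cong (*-congˡ (line-cong l z₁≈0 z₂≈0 0F)) (*-congˡ (line-cong l z₁≈0 z₂≈0 1F)) ⟩
      f₁ * (0# * A l 0F + 0# * B l 0F) + f₂ * (0# * A l 1F + 0# * B l 1F)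
        ≈⟨ solve 6 (λ f₁ f₂ a b c d → f₁ :* (:0 :* a :+ :0 :* b) :+ f₂ :* (:0 :* c :+ :0 :* d) := :0) refl
             f₁ f₂ (A l 0F) (B l 0F) (A l 1F) (B l 1F) ⟩
      0# ∎)
    -- The value of a that makes f orthogonal to the first half of v - a P. As u annihilates both v
    -- and P, it annihilates the difference, and the orthogonality of g to the second half follows.
    a : Carrier
    a = (f₁ * v 0F + f₂ * v 1F) * proj₁ (inv _ fP≉0)
    afP≈ : a * (f₁ * P 0F + f₂ * P 1F) ≈ f₁ * v 0F + f₂ * v 1F
    afP≈ = trans (*-assoc _ _ _) (trans (*-congˡ (trans (*-comm _ _) (proj₂ (inv _ fP≉0)))) (*-identityʳ _))
    rest : Fin 4 → Carrier
    rest i = v i - a * P i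
    f·rest : f₁ * rest 0F + f₂ * rest 1F ≈ 0#
    f·rest = trans
      (solve 7 (λ f₁ f₂ v₀ v₁ a p₀ p₁ → f₁ :* (v₀ :- a :* p₀) :+ f₂ :* (v₁ :- a :* p₁)
          := f₁ :* v₀ :+ f₂ :* v₁ :- a :* (f₁ :* p₀ :+ f₂ :* p₁))
        refl f₁ f₂ (v 0F) (v 1F) a (P 0F) (P 1F))
      (x≈y⇒x-y≈0 (sym afP≈))
    g·rest : g₁ * rest 2F + g₂ * rest 3F ≈ 0#
    g·rest = begin
      g₁ * rest 2F + g₂ * rest 3F
        ≈⟨ solve 9 (λ g₁ g₂ v₂ v₃ a p₂ p₃ fv fp → g₁ :* (v₂ :- a :* p₂) :+ g₂ :* (v₃ :- a :* p₃)
             := (fv :+ (g₁ :* v₂ :+ g₂ :* v₃)) :- a :* (fp :+ (g₁ :* p₂ :+ g₂ :* p₃)) :+ (a :* fp :- fv))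
             refl g₁ g₂ (v 2F) (v 3F) a (P 2F) (P 3F) (f₁ * v 0F + f₂ * v 1F) (f₁ * P 0F + f₂ * P 1F) ⟩
      ((f₁ * v 0F + f₂ * v 1F) + (g₁ * v 2F + g₂ * v 3F)) - a * ((f₁ * P 0F + f₂ * P 1F) + (g₁ * P 2F + g₂ * P 3F))
        + (a * (f₁ * P 0F + f₂ * P 1F) - (f₁ * v 0F + f₂ * v 1F))
        ≈⟨ +-cong (+-cong uv≈0 (-‿cong (*-congˡ uP≈0))) (x≈y⇒x-y≈0 afP≈) ⟩
      0# - a * 0# + 0#
        ≈⟨ solve 1 (λ a → :0 :- a :* :0 :+ :0 := :0) refl a ⟩
      0# ∎
    assemble : (∃₂ λ s b → rest 0F ≈ b * px s × rest 1F ≈ b * py s) →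
               (∃₂ λ s b → rest 2F ≈ b * px s × rest 3F ≈ b * py s) →
               (∃₂ λ s b → z₁ ≈ b * px s × z₂ ≈ b * py s) → Triple col v
    assemble (s₁ , b₁ , x₁≈ , y₁≈) (s₂ , b₂ , x₂≈ , y₂≈) (s₃ , b₃ , z₁≈ , z₂≈) =
      threeLines (λ ()) 0≢l 1≢l b₁ b₂ (a * b₃) s₁ s₂ s₃ λ i → begin
        b₁ * col (0F , s₁) i + b₂ * col (1F , s₂) i + (a * b₃) * col (l , s₃) i
          ≈⟨ +-cong (+-cong (line-*ˡ 0F b₁ _ _ i) (line-*ˡ 1F b₂ _ _ i))
               (trans (*-congˡ (line-*ˡ l b₃ _ _ i)) (sym (*-assoc a b₃ _))) ⟨
        line 0F (b₁ * px s₁) (b₁ * py s₁) i + line 1F (b₂ * px s₂) (b₂ * py s₂) i + a * line l (b₃ * px s₃) (b₃ * py s₃) i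
          ≈⟨ +-cong (+-cong (line-cong 0F x₁≈ y₁≈ i) (line-cong 1F x₂≈ y₂≈ i)) (*-congˡ (line-cong l z₁≈ z₂≈ i)) ⟨
        line 0F (rest 0F) (rest 1F) i + line 1F (rest 2F) (rest 3F) i + a * P i
          ≈⟨ +-congʳ (halves rest i) ⟩
        v i - a * P i + a * P i
          ≈⟨ solve 2 (λ x y → x :- y :+ y := x) refl (v i) (a * P i) ⟩
        v i ∎

  -- If both determinants vanish, then g and g A are proportional to f, so g is an eigenvector of A.
  no-eigenvector : ∀ {f₁ f₂ g₁ g₂} → InK g₁ → InK g₂ → ¬ (f₁ ≈ 0# × f₂ ≈ 0#) → ¬ (g₁ ≈ 0# × g₂ ≈ 0#) →
                   f₁ * g₂ ≈ f₂ * g₁ → ¬ f₁ * (m * g₁ + g₂) ≈ f₂ * g₂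
  no-eigenvector {f₁} {f₂} {g₁} {g₂} g₁∈ g₂∈ f≉0 g≉0 e e′ = case (f₁ ≟ 0#) of λ where
      (yes f₁≈0) → g≉0 ( *-cancel-≉0 (f₂≉0 f₁≈0) (trans (sym e) (trans (*-congʳ f₁≈0) (zeroˡ _)))
                       , *-cancel-≉0 (f₂≉0 f₁≈0) (trans (sym e′) (trans (*-congʳ f₁≈0) (zeroˡ _))))
      (no f₁≉0)  → eigenvalue f₁≉0
    where
    f₂≉0 : f₁ ≈ 0# → ¬ f₂ ≈ 0#
    f₂≉0 f₁≈0 f₂≈0 = f≉0 (f₁≈0 , f₂≈0)
    eigenvalue : ¬ ¬ f₁ ≈ 0#
    eigenvalue f₁≉0 = root
      where
      char : g₁ * (m * g₁ + g₂) ≈ g₂ * g₂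
      char = *-cancelˡ-≉0 f₁≉0 (begin
        f₁ * (g₁ * (m * g₁ + g₂))   ≈⟨ solve 3 (λ a b c → a :* (b :* c) := b :* (a :* c)) refl f₁ g₁ (m * g₁ + g₂) ⟩
        g₁ * (f₁ * (m * g₁ + g₂))   ≈⟨ *-congˡ e′ ⟩
        g₁ * (f₂ * g₂)              ≈⟨ solve 3 (λ a b c → b :* (a :* c) := c :* (a :* b)) refl f₂ g₁ g₂ ⟩
        g₂ * (f₂ * g₁)              ≈⟨ *-congˡ e ⟨
        g₂ * (f₁ * g₂)              ≈⟨ solve 2 (λ a c → c :* (a :* c) := a :* (c :* c)) refl f₁ g₂ ⟩
        f₁ * (g₂ * g₂)              ∎)
      g₁≉0 : ¬ g₁ ≈ 0#
      g₁≉0 g₁≈0 = g≉0 (g₁≈0 , ^-≈0 g₂ 2 (begin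
        g₂ * (g₂ * 1#)        ≈⟨ *-congˡ (*-identityʳ g₂) ⟩
        g₂ * g₂               ≈⟨ char ⟨
        g₁ * (m * g₁ + g₂)    ≈⟨ trans (*-congʳ g₁≈0) (zeroˡ _) ⟩
        0#                    ∎))
      -- Dividing `char` by g₁² gives m + t = t² for t = g₂ / g₁ in K, against the choice of m.
      root = let z , g₁z≈1 = inv g₁ g₁≉0
                 t = g₂ * z
        in proj₂ (proj₂ non-norm) t (*∈K g₂∈ (inv∈K g₁z≈1 g₁∈)) (begin
          t * t - t
            ≈⟨ solve 2 (λ c z → c :* z :* (c :* z) :- c :* z := z :* z :* (c :* c) :- c :* z) refl g₂ z ⟩
          z * z * (g₂ * g₂) - t
            ≈⟨ +-congʳ (*-congˡ char) ⟨
          z * z * (g₁ * (m * g₁ + g₂)) - t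
            ≈⟨ solve 4 (λ b c z m → z :* z :* (b :* (m :* b :+ c)) :- c :* z := m :* (b :* z) :* (b :* z) :+ (b :* z) :* (c :* z) :- c :* z) refl g₁ g₂ z m ⟩
          m * (g₁ * z) * (g₁ * z) + (g₁ * z) * t - t
            ≈⟨ +-congʳ (+-cong (*-cong (*-congˡ g₁z≈1) g₁z≈1) (*-congʳ g₁z≈1)) ⟩
          m * 1# * 1# + 1# * t - t
            ≈⟨ solve 2 (λ m t → m :* :1 :* :1 :+ :1 :* t :- t := m) refl m t ⟩
          m ∎)

  exactlyThree : ∀ v → Triple col v
  exactlyThree v = let u , u∈ , u≉0 , uv≈0 = annihilator v in
    cover (u∈ 0F) (u∈ 1F) (u∈ 2F) (u∈ 3F) (λ (e₀ , e₁) (e₂ , e₃) → u≉0 λ { 0F → e₀ ; 1F → e₁ ; 2F → e₂ ; 3F → e₃ }) uv≈0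
    where
    cover : ∀ {f₁ f₂ g₁ g₂} → InK f₁ → InK f₂ → InK g₁ → InK g₂ → (f₁ ≈ 0# × f₂ ≈ 0# → ¬ (g₁ ≈ 0# × g₂ ≈ 0#)) →
            (f₁ * v 0F + f₂ * v 1F) + (g₁ * v 2F + g₂ * v 3F) ≈ 0# → Triple col v
    cover {f₁} {f₂} {g₁} {g₂} f₁∈ f₂∈ g₁∈ g₂∈ fg≉0 uv≈0
      with (f₁ ≟ 0#) ×-dec (f₂ ≟ 0#) | (g₁ ≟ 0#) ×-dec (g₂ ≟ 0#) | f₁ * g₂ ≟ f₂ * g₁ | f₁ * (m * g₁ + g₂) ≟ f₂ * g₂
    ... | yes f≈0@(f₁≈0 , f₂≈0) | _ | _ | _ =
      let s , a , v₂≈ , v₃≈ = perp g₁∈ g₂∈ (fg≉0 f≈0) (begin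
            g₁ * v 2F + g₂ * v 3F
              ≈⟨ solve 3 (λ x y z → z := :0 :* x :+ :0 :* y :+ z) refl (v 0F) (v 1F) _ ⟩
            (0# * v 0F + 0# * v 1F) + (g₁ * v 2F + g₂ * v 3F)
              ≈⟨ +-congʳ (+-cong (*-congʳ f₁≈0) (*-congʳ f₂≈0)) ⟨
            (f₁ * v 0F + f₂ * v 1F) + (g₁ * v 2F + g₂ * v 3F)
              ≈⟨ uv≈0 ⟩
            0# ∎)
      in twoLines {0F} {1F} (λ ()) (v 0F) (v 1F) a s λ i →
        trans (+-congˡ (trans (sym (line-*ˡ 1F a _ _ i)) (line-cong 1F (sym v₂≈) (sym v₃≈) i))) (halves v i)
    ... | no f≉0 | yes (g₁≈0 , g₂≈0) | _ | _ =
      let s , a , v₀≈ , v₁≈ = perp f₁∈ f₂∈ f≉0 (begin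
            f₁ * v 0F + f₂ * v 1F
              ≈⟨ solve 3 (λ x y z → z := z :+ (:0 :* x :+ :0 :* y)) refl (v 2F) (v 3F) _ ⟩
            (f₁ * v 0F + f₂ * v 1F) + (0# * v 2F + 0# * v 3F)
              ≈⟨ +-congˡ (+-cong (*-congʳ g₁≈0) (*-congʳ g₂≈0)) ⟨
            (f₁ * v 0F + f₂ * v 1F) + (g₁ * v 2F + g₂ * v 3F)
              ≈⟨ uv≈0 ⟩
            0# ∎)
      in twoLines {1F} {0F} (λ ()) (v 2F) (v 3F) a s λ i →
        trans (+-congˡ (trans (sym (line-*ˡ 0F a _ _ i)) (line-cong 0F (sym v₀≈) (sym v₁≈) i))) (trans (+-comm _ _) (halves v i))
    ... | no f≉0 | no g≉0 | no det≉ | _ =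
      -- The point (x , x) lies in the plane when x is orthogonal to f + g, which gives x = (- (f₂ +
      -- g₂) , f₁ + g₁); then f · x = f₂ g₁ - f₁ g₂.
      thirdPoint f₁∈ f₂∈ g₁∈ g₂∈ f≉0 g≉0 v uv≈0 2F (λ ()) (λ ()) (-∈K (+∈K f₂∈ g₂∈)) (+∈K f₁∈ g₁∈)
        (λ e → det≉ (sym (x-y≈0⇒x≈y _ _ (trans (solve 4 (λ f₁ f₂ g₁ g₂ → let x = :- (f₂ :+ g₂) ; y = f₁ :+ g₁ in
            f₂ :* g₁ :- f₁ :* g₂ := f₁ :* (x :* :1 :+ y :* :0) :+ f₂ :* (x :* :0 :+ y :* :1)) refl f₁ f₂ g₁ g₂) e))))
        (solve 4 (λ f₁ f₂ g₁ g₂ → let x = :- (f₂ :+ g₂) ; y = f₁ :+ g₁ in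
            f₁ :* (x :* :1 :+ y :* :0) :+ f₂ :* (x :* :0 :+ y :* :1)
              :+ (g₁ :* (x :* :1 :+ y :* :0) :+ g₂ :* (x :* :0 :+ y :* :1)) := :0) refl f₁ f₂ g₁ g₂)
    ... | no f≉0 | no g≉0 | yes e | no det≉ =
      -- For (x , A x) the vector x has to be orthogonal to f + g A, where g A = (g₂ , m g₁ + g₂);
      -- then f · x = f₂ g₂ - f₁ (m g₁ + g₂).
      thirdPoint f₁∈ f₂∈ g₁∈ g₂∈ f≉0 g≉0 v uv≈0 3F (λ ()) (λ ()) (-∈K (+∈K f₂∈ (+∈K (*∈K m∈ g₁∈) g₂∈))) (+∈K f₁∈ g₂∈)
        (λ e → det≉ (sym (x-y≈0⇒x≈y _ _ (trans (solve 5 (λ m f₁ f₂ g₁ g₂ → let x = :- (f₂ :+ (m :* g₁ :+ g₂)) ; y = f₁ :+ g₂ in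
            f₂ :* g₂ :- f₁ :* (m :* g₁ :+ g₂) := f₁ :* (x :* :1 :+ y :* :0) :+ f₂ :* (x :* :0 :+ y :* :1)) refl m f₁ f₂ g₁ g₂) e))))
        (solve 5 (λ m f₁ f₂ g₁ g₂ → let x = :- (f₂ :+ (m :* g₁ :+ g₂)) ; y = f₁ :+ g₂ in
            f₁ :* (x :* :1 :+ y :* :0) :+ f₂ :* (x :* :0 :+ y :* :1)
              :+ (g₁ :* (x :* :0 :+ y :* m) :+ g₂ :* (x :* :1 :+ y :* :1)) := :0) refl m f₁ f₂ g₁ g₂)
    ... | no f≉0 | no g≉0 | yes e | yes e′ = contradiction e′ (no-eigenvector g₁∈ g₂∈ f≉0 g≉0 e)

-- Lengthening the code

module _ {c ℓ : Level} {q : ℕ} (F : FiniteField c ℓ q) where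
  open FieldTheory F
  open SetoidReasoning setoid

  sub-≉0 : ∀ {x y} → ¬ x ≈ y → ¬ x - y ≈ 0#
  sub-≉0 x≉y e = x≉y (x-y≈0⇒x≈y _ _ e)

  -- Elimination: z₂ and z₃ below stand for (β₂ − β₁) y₂ and (β₃ − β₁) y₃.
  vandermonde : ∀ β₁ β₂ β₃ → ¬ β₂ ≈ β₁ → ¬ β₃ ≈ β₁ → ¬ β₃ ≈ β₂ → ∀ b₀ b₁ b₂ → ∃₂ λ y₁ y₂ → ∃ λ y₃ →
    (y₁ + y₂ + y₃ ≈ b₀) × (β₁ * y₁ + β₂ * y₂ + β₃ * y₃ ≈ b₁) ×
    (β₁ * β₁ * y₁ + β₂ * β₂ * y₂ + β₃ * β₃ * y₃ ≈ b₂)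
  vandermonde β₁ β₂ β₃ β₂≉β₁ β₃≉β₁ β₃≉β₂ b₀ b₁ b₂ = y₁ , y₂ , y₃ , eq₀ , eq₁ , eq₂
    where
    divide : ∀ {x y} → ¬ x ≈ y → ∀ z → ∃ λ w → (x - y) * w ≈ z
    divide x≉y z = let u , e = inv _ (sub-≉0 x≉y) in
      u * z , trans (sym (*-assoc _ u z)) (trans (*-congʳ e) (*-identityˡ z))
    z₃ = proj₁ (divide β₃≉β₂ (b₂ - β₁ * b₁ - β₂ * (b₁ - β₁ * b₀)))
    z₃≈ = proj₂ (divide β₃≉β₂ (b₂ - β₁ * b₁ - β₂ * (b₁ - β₁ * b₀)))
    z₂ = b₁ - β₁ * b₀ - z₃
    y₂ = proj₁ (divide β₂≉β₁ z₂)
    y₂≈ = proj₂ (divide β₂≉β₁ z₂)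
    y₃ = proj₁ (divide β₃≉β₁ z₃)
    y₃≈ = proj₂ (divide β₃≉β₁ z₃)
    y₁ = b₀ - y₂ - y₃
    eq₀ : y₁ + y₂ + y₃ ≈ b₀
    eq₀ = solve 3 (λ b y₂ y₃ → b :- y₂ :- y₃ :+ y₂ :+ y₃ := b) refl b₀ y₂ y₃
    eq₁ : β₁ * y₁ + β₂ * y₂ + β₃ * y₃ ≈ b₁
    eq₁ = begin
      β₁ * y₁ + β₂ * y₂ + β₃ * y₃
        ≈⟨ solve 6 (λ β₁ β₂ β₃ b y₂ y₃ → β₁ :* (b :- y₂ :- y₃) :+ β₂ :* y₂ :+ β₃ :* y₃
             := β₁ :* b :+ (β₂ :- β₁) :* y₂ :+ (β₃ :- β₁) :* y₃) refl β₁ β₂ β₃ b₀ y₂ y₃ ⟩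
      β₁ * b₀ + (β₂ - β₁) * y₂ + (β₃ - β₁) * y₃
        ≈⟨ +-cong (+-congˡ y₂≈) y₃≈ ⟩
      β₁ * b₀ + (b₁ - β₁ * b₀ - z₃) + z₃
        ≈⟨ solve 3 (λ x y z → x :+ (y :- x :- z) :+ z := y) refl (β₁ * b₀) b₁ z₃ ⟩
      b₁ ∎
    eq₂ : β₁ * β₁ * y₁ + β₂ * β₂ * y₂ + β₃ * β₃ * y₃ ≈ b₂
    eq₂ = begin
      β₁ * β₁ * y₁ + β₂ * β₂ * y₂ + β₃ * β₃ * y₃
        ≈⟨ solve 6 (λ β₁ β₂ β₃ b y₂ y₃ → β₁ :* β₁ :* (b :- y₂ :- y₃) :+ β₂ :* β₂ :* y₂ :+ β₃ :* β₃ :* y₃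
             := β₁ :* β₁ :* b :+ (β₂ :+ β₁) :* ((β₂ :- β₁) :* y₂) :+ (β₃ :+ β₁) :* ((β₃ :- β₁) :* y₃)) refl β₁ β₂ β₃ b₀ y₂ y₃ ⟩
      β₁ * β₁ * b₀ + (β₂ + β₁) * ((β₂ - β₁) * y₂) + (β₃ + β₁) * ((β₃ - β₁) * y₃)
        ≈⟨ +-cong (+-congˡ (*-congˡ y₂≈)) (*-congˡ y₃≈) ⟩
      β₁ * β₁ * b₀ + (β₂ + β₁) * z₂ + (β₃ + β₁) * z₃
        ≈⟨ solve 6 (λ β₁ β₂ β₃ b₀ b₁ z₃ → β₁ :* β₁ :* b₀ :+ (β₂ :+ β₁) :* (b₁ :- β₁ :* b₀ :- z₃) :+ (β₃ :+ β₁) :* z₃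
             := β₁ :* b₁ :+ β₂ :* (b₁ :- β₁ :* b₀) :+ (β₃ :- β₂) :* z₃) refl β₁ β₂ β₃ b₀ b₁ z₃ ⟩
      β₁ * b₁ + β₂ * (b₁ - β₁ * b₀) + (β₃ - β₂) * z₃
        ≈⟨ +-congˡ z₃≈ ⟩
      β₁ * b₁ + β₂ * (b₁ - β₁ * b₀) + (b₂ - β₁ * b₁ - β₂ * (b₁ - β₁ * b₀))
        ≈⟨ solve 3 (λ x y z → x :+ y :+ (z :- x :- y) := z) refl (β₁ * b₁) (β₂ * (b₁ - β₁ * b₀)) b₂ ⟩
      b₂ ∎

  -- The q^m-concatenating construction: the columns are (h_j , ξ , β_j ξ , β_j² ξ) with ξ ∈ F^m.
  module Concatenation {J : Set} {r₀ : ℕ} (h : J → Fin r₀ → Carrier) (exactlyThree : ∀ v → Triple h v)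
      (β : J → Carrier) (β-injective : ∀ {j j′} → β j ≈ β j′ → j ≡ j′) {m n r : ℕ}
      (column : Fin n → J × (Fin m → Fin q)) (column⁻¹ : J → (Fin m → Fin q) → Fin n)
      (column-j : ∀ j ξ → proj₁ (column (column⁻¹ j ξ)) ≡ j)
      (column-ξ : ∀ j ξ i → proj₂ (column (column⁻¹ j ξ)) i ≡ ξ i)
      (row : Fin r → Fin r₀ ⊎ Fin 3 × Fin m) (row⁻¹ : Fin r₀ ⊎ Fin 3 × Fin m → Fin r)
      (row⁻¹-row : ∀ i → row⁻¹ (row i) ≡ i) where

    entry : J → (Fin m → Carrier) → Fin r₀ ⊎ Fin 3 × Fin m → Carrier
    entry j ξ (inj₁ i)       = h j i
    entry j ξ (inj₂ (e , i)) = β j ^ toℕ e * ξ i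

    H : Fin r → Fin n → Carrier
    H i s = entry (proj₁ (column s)) (enum ∘ proj₂ (column s)) (row i)

    H-column⁻¹ : ∀ j ξ i → H i (column⁻¹ j (index ∘ ξ)) ≈ entry j ξ (row i)
    H-column⁻¹ j ξ i with row i
    ... | inj₁ i′       = reflexive (≡.cong (λ j → h j i′) (column-j j _))
    ... | inj₂ (e , i′) = *-cong (reflexive (≡.cong (λ j → β j ^ toℕ e) (column-j j _)))
      (trans (reflexive (≡.cong enum (column-ξ j _ i′))) (enum-index (ξ i′)))

    covers : CoversWithin F H 3
    covers v = 3 , ℕ.≤-refl , idx , coef , λ i → begin
        ∑ F (λ j → coef j * H i (idx j))
          ≈⟨ +-cong (*-congˡ (H-column⁻¹ j₁ ξ₁ i)) (+-cong (*-congˡ (H-column⁻¹ j₂ ξ₂ i)) (+-congʳ (*-congˡ (H-column⁻¹ j₃ ξ₃ i)))) ⟩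
        combination₃ (row i)
          ≈⟨ combines (row i) ⟩
        v (row⁻¹ (row i))
          ≡⟨ ≡.cong v (row⁻¹-row i) ⟩
        v i ∎
      where
      open Triple (exactlyThree (v ∘ row⁻¹ ∘ inj₁))
      sol = λ i → vandermonde (β j₁) (β j₂) (β j₃) (j₁≢j₂ ∘ ≡.sym ∘ β-injective) (j₁≢j₃ ∘ ≡.sym ∘ β-injective) (j₂≢j₃ ∘ ≡.sym ∘ β-injective)
            (v (row⁻¹ (inj₂ (0F , i)))) (v (row⁻¹ (inj₂ (1F , i)))) (v (row⁻¹ (inj₂ (2F , i))))
      scale : ∀ {a} → ¬ a ≈ 0# → Carrier → Carrier
      scale a≉0 y = proj₁ (inv _ a≉0) * y
      scale≈ : ∀ {a} (a≉0 : ¬ a ≈ 0#) x y → a * (x * scale a≉0 y) ≈ x * y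
      scale≈ {a} a≉0 x y = let z , az≈1 = inv a a≉0 in
        trans (solve 4 (λ a x y z → a :* (x :* (z :* y)) := (a :* z) :* (x :* y)) refl a x y z) (trans (*-congʳ az≈1) (*-identityˡ _))
      y₁ y₂ y₃ ξ₁ ξ₂ ξ₃ : Fin m → Carrier
      y₁ i = proj₁ (sol i)
      y₂ i = proj₁ (proj₂ (sol i))
      y₃ i = proj₁ (proj₂ (proj₂ (sol i)))
      -- The coefficients are already fixed by the rows of h, and the Vandermonde system determines
      -- only the products of coefficient and ξ; hence the division.
      ξ₁ = scale c₁≉0 ∘ y₁
      ξ₂ = scale c₂≉0 ∘ y₂
      ξ₃ = scale c₃≉0 ∘ y₃
      idx : Fin 3 → Fin n
      idx 0F = column⁻¹ j₁ (index ∘ ξ₁)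
      idx 1F = column⁻¹ j₂ (index ∘ ξ₂)
      idx 2F = column⁻¹ j₃ (index ∘ ξ₃)
      coef : Fin 3 → Carrier
      coef 0F = c₁
      coef 1F = c₂
      coef 2F = c₃
      rescaled : ∀ e i → c₁ * (β j₁ ^ e * ξ₁ i) + (c₂ * (β j₂ ^ e * ξ₂ i) + (c₃ * (β j₃ ^ e * ξ₃ i) + 0#))
        ≈ β j₁ ^ e * y₁ i + (β j₂ ^ e * y₂ i + (β j₃ ^ e * y₃ i + 0#))
      rescaled e i = +-cong (scale≈ c₁≉0 _ _) (+-cong (scale≈ c₂≉0 _ _) (+-congʳ (scale≈ c₃≉0 _ _)))
      combination₃ : Fin r₀ ⊎ Fin 3 × Fin m → Carrier
      combination₃ i = c₁ * entry j₁ ξ₁ i + (c₂ * entry j₂ ξ₂ i + (c₃ * entry j₃ ξ₃ i + 0#))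
      combines : ∀ i → combination₃ i ≈ v (row⁻¹ i)
      combines (inj₁ i) = trans (solve 3 (λ x y z → x :+ (y :+ (z :+ :0)) := x :+ y :+ z) refl _ _ _) (combination i)
      combines (inj₂ (0F , i)) = trans (rescaled 0 i) (trans
        (solve 3 (λ x y z → :1 :* x :+ (:1 :* y :+ (:1 :* z :+ :0)) := x :+ y :+ z) refl _ _ _)
        (proj₁ (proj₂ (proj₂ (proj₂ (sol i))))))
      combines (inj₂ (1F , i)) = trans (rescaled 1 i) (trans
        (solve 6 (λ a b c x y z → a :* :1 :* x :+ (b :* :1 :* y :+ (c :* :1 :* z :+ :0)) := a :* x :+ b :* y :+ c :* z) refl _ _ _ _ _ _)
        (proj₁ (proj₂ (proj₂ (proj₂ (proj₂ (sol i)))))))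
      combines (inj₂ (2F , i)) = trans (rescaled 2 i) (trans
        (solve 6 (λ a b c x y z → a :* (a :* :1) :* x :+ (b :* (b :* :1) :* y :+ (c :* (c :* :1) :* z :+ :0))
          := a :* a :* x :+ b :* b :* y :+ c :* c :* z) refl _ _ _ _ _ _)
        (proj₂ (proj₂ (proj₂ (proj₂ (proj₂ (sol i)))))))

  -- Index zero stands for the zero vector, any other index for a scalar and a column. Padding by
  -- the zero vector turns at most two columns into exactly two out of 1 + n q terms.
  term : ∀ {r n} → (Fin r → Fin n → Carrier) → Fin (suc (n ℕ.* q)) → Fin r → Carrier
  term H Fin.zero    i = 0#
  term {n = n} H (Fin.suc s) i = enum (proj₂ (Fin.remQuot {n} q s)) * H i (proj₁ (Fin.remQuot {n} q s))

  term-combine : ∀ {r n} (H : Fin r → Fin n → Carrier) j a i → term H (Fin.suc (Fin.combine j (index a))) i ≈ a * H i j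
  term-combine H j a i = trans
    (reflexive (≡.cong (λ (j , s) → enum s * H i j) (Fin.remQuot-combine j (index a))))
    (*-congʳ (enum-index a))

  twoTerms : ∀ {r n R} (H : Fin r → Fin n → Carrier) → R < 3 → ∀ {v} → CombOfAtMost F H R v →
             ∃₂ λ s s′ → ∀ i → term H s i + term H s′ i ≈ v i
  twoTerms H R<3 (zero , k≤R , idx , a , v≈) = Fin.zero , Fin.zero , λ i → trans (+-identityˡ 0#) (v≈ i)
  twoTerms H R<3 (suc zero , k≤R , idx , a , v≈) =
    Fin.suc (Fin.combine (idx 0F) (index (a 0F))) , Fin.zero , λ i → trans (+-congʳ (term-combine H _ _ i)) (v≈ i)
  twoTerms H R<3 (suc (suc zero) , k≤R , idx , a , v≈) =
    Fin.suc (Fin.combine (idx 0F) (index (a 0F))) , Fin.suc (Fin.combine (idx 1F) (index (a 1F))) , λ i →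
    trans (+-cong (term-combine H _ _ i) (trans (term-combine H _ _ i) (sym (+-identityʳ _)))) (v≈ i)
  twoTerms H R<3 (suc (suc (suc k)) , k≤R , _) = contradiction (ℕ.≤-trans (s≤s k≤R) R<3) λ { (s≤s (s≤s (s≤s ()))) }

  -- Two terms determine their sum, so choosing two terms for each vector would embed the q^r
  -- vectors into the pairs of terms.
  coveringRadius≥3 : ∀ {r n} (H : Fin r → Fin n → Carrier) → suc (n ℕ.* q) ℕ.* suc (n ℕ.* q) < q ℕ.^ r →
                     ∀ R → R < 3 → ¬ CoversWithin F H R
  coveringRadius≥3 {r} {n} H few R R<3 covers =
    let w , w′ , w<w′ , e = Fin.pigeonhole few (λ w → Fin.combine (s w) (s′ w))
        s≡ , s′≡ = Fin.combine-injective (s w) (s′ w) (s w′) (s′ w′) e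
    in Fin.<⇒≢ w<w′ (finToFun-injective {r} {q} λ i → enum-injective (begin
      vec w i                            ≈⟨ s≈ w i ⟨
      term H (s w) i + term H (s′ w) i   ≡⟨ ≡.cong₂ (λ s s′ → term H s i + term H s′ i) s≡ s′≡ ⟩
      term H (s w′) i + term H (s′ w′) i ≈⟨ s≈ w′ i ⟩
      vec w′ i                           ∎))
    where
    vec : Fin (q ℕ.^ r) → Fin r → Carrier
    vec w i = enum (finToFun {q} {r} w i)
    s s′ : Fin (q ℕ.^ r) → Fin (suc (n ℕ.* q))
    s w = proj₁ (twoTerms H R<3 (covers (vec w)))
    s′ w = proj₁ (proj₂ (twoTerms H R<3 (covers (vec w))))
    s≈ : ∀ w i → term H (s w) i + term H (s′ w) i ≈ vec w i
    s≈ w = proj₂ (proj₂ (twoTerms H R<3 (covers (vec w))))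

-- Covering density

open import Data.Integer as ℤ using (+_)
open import Data.Nat using (_+_; _*_; _^_)
open import Data.Rational using (ℚ; _-_) renaming (_+_ to _+ℚ_)
open ≡ using (refl; sym; trans; cong; cong₂; subst)

frac-< : ∀ a b c d → 0 < b → 0 < d → a * d < c * b → frac a b ℚ.< frac c d
frac-< a (suc b) c (suc d) _ _ ad<cb = ℚ.toℚᵘ-cancel-<
  (ℚᵘ.<-respˡ-≃ (ℚᵘ.≃-sym (ℚ.toℚᵘ-fromℚᵘ (mkℚᵘ (+ a) b)))
  (ℚᵘ.<-respʳ-≃ (ℚᵘ.≃-sym (ℚ.toℚᵘ-fromℚᵘ (mkℚᵘ (+ c) d)))
  (*<* (≡.subst₂ ℤ._<_ (ℤ.pos-* a (suc d)) (ℤ.pos-* c (suc b)) (ℤ.+<+ ad<cb)))))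

frac-cong : ∀ a b c d → 0 < b → 0 < d → a * d ≡ c * b → frac a b ≡ frac c d
frac-cong a (suc b) c (suc d) _ _ ad≡cb = ℚ.fromℚᵘ-cong {mkℚᵘ (+ a) b} {mkℚᵘ (+ c) d}
  (*≡* (trans (sym (ℤ.pos-* a (suc d))) (trans (cong +_ ad≡cb) (ℤ.pos-* c (suc b)))))

frac-+ : ∀ {d} a b → 0 < d → frac a d ℚ.+ frac b d ≡ frac (a + b) d
frac-+ {suc d} a b _ = ℚ.toℚᵘ-injective (begin
  toℚᵘ (frac a (suc d) ℚ.+ frac b (suc d))
    ≈⟨ ℚ.toℚᵘ-homo-+ (frac a (suc d)) (frac b (suc d)) ⟩
  toℚᵘ (frac a (suc d)) ℚᵘ.+ toℚᵘ (frac b (suc d))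
    ≈⟨ ℚᵘ.+-cong (ℚ.toℚᵘ-fromℚᵘ (mkℚᵘ (+ a) d)) (ℚ.toℚᵘ-fromℚᵘ (mkℚᵘ (+ b) d)) ⟩
  mkℚᵘ (+ a) d ℚᵘ.+ mkℚᵘ (+ b) d
    ≈⟨ *≡* (trans (cong (ℤ._* + suc d) (sym (ℤ.*-distribʳ-+ (+ suc d) (+ a) (+ b)))) (trans (ℤ.*-assoc (+ (a + b)) (+ suc d) (+ suc d))
         (cong (+ (a + b) ℤ.*_) (sym (ℤ.pos-* (suc d) (suc d)))))) ⟩
  mkℚᵘ (+ (a + b)) d
    ≈⟨ ℚ.toℚᵘ-fromℚᵘ (mkℚᵘ (+ (a + b)) d) ⟨
  toℚᵘ (frac (a + b) (suc d)) ∎)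
  where open import Relation.Binary.Reasoning.Setoid ℚᵘ.≃-setoid

-- Moving the one negative term of the density bound to the other side keeps all numerators natural
-- numbers.
<-minus : ∀ {x y z} → x ℚ.+ y ℚ.< z → x ℚ.< z ℚ.- y
<-minus {x} {y} {z} x+y<z = subst (ℚ._< z ℚ.- y) eq (ℚ.+-monoˡ-< (ℚ.- y) x+y<z)
  where
  eq : x ℚ.+ y ℚ.- y ≡ x
  eq = trans (ℚ.+-assoc x y (ℚ.- y)) (trans (cong (x ℚ.+_) (ℚ.+-inverseʳ y)) (ℚ.+-identityʳ x))

2C≤ : ∀ n → 2 * (n C 2) ≤ n * n
2C≤ zero    = z≤n
2C≤ (suc n) = begin
  2 * (suc n C 2)                  ≡⟨ cong (2 *_) (nCk+nC[k+1]≡[n+1]C[k+1] n 1) ⟨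
  2 * (n C 1 + n C 2)              ≡⟨ cong (λ m → 2 * (m + n C 2)) (nC1≡n n) ⟩
  2 * (n + n C 2)                  ≡⟨ ℕ.*-distribˡ-+ 2 n (n C 2) ⟩
  2 * n + 2 * (n C 2)              ≤⟨ ℕ.+-monoʳ-≤ (2 * n) (2C≤ n) ⟩
  2 * n + n * n                    ≤⟨ ℕ.m≤n+m _ 1 ⟩
  1 + (2 * n + n * n)              ≡⟨ ℕ-solve 1 (λ n → ℕ-con 1 ⊕ (ℕ-con 2 ⊗ n ⊕ n ⊗ n) ⊜ (ℕ-con 1 ⊕ n) ⊗ (ℕ-con 1 ⊕ n)) refl n ⟩
  suc n * suc n                    ∎
  where open ℕ.≤-Reasoning

6C≤ : ∀ n → 6 * (n C 3) ≤ n * n * n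
6C≤ zero    = z≤n
6C≤ (suc n) = begin
  6 * (suc n C 3)                  ≡⟨ cong (6 *_) (nCk+nC[k+1]≡[n+1]C[k+1] n 2) ⟨
  6 * (n C 2 + n C 3)              ≡⟨ ℕ-solve 2 (λ x y → ℕ-con 6 ⊗ (x ⊕ y) ⊜ ℕ-con 3 ⊗ (ℕ-con 2 ⊗ x) ⊕ ℕ-con 6 ⊗ y) refl (n C 2) (n C 3) ⟩
  3 * (2 * (n C 2)) + 6 * (n C 3)  ≤⟨ ℕ.+-mono-≤ (ℕ.*-monoʳ-≤ 3 (2C≤ n)) (6C≤ n) ⟩
  3 * (n * n) + n * n * n          ≤⟨ ℕ.m≤n+m _ (1 + 3 * n) ⟩
  1 + 3 * n + (3 * (n * n) + n * n * n)
                                   ≡⟨ ℕ-solve 1 (λ n → ℕ-con 1 ⊕ ℕ-con 3 ⊗ n ⊕ (ℕ-con 3 ⊗ (n ⊗ n) ⊕ n ⊗ n ⊗ n)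
                                        ⊜ (ℕ-con 1 ⊕ n) ⊗ (ℕ-con 1 ⊕ n) ⊗ (ℕ-con 1 ⊕ n)) refl n ⟩
  suc n * suc n * suc n            ∎
  where open ℕ.≤-Reasoning

6V≤ : ∀ q n → (let e = q ∸ 1) → V q n 3 * 6 ≤ 6 + 6 * (e * n) + 3 * (e * e * (n * n)) + e * e * e * (n * n * n)
6V≤ q n = begin
  V q n 3 * 6
    ≡⟨ ℕ-solve 4 (λ e x y z → (ℕ-con 1 ⊕ e ⊗ ℕ-con 1 ⊗ x ⊕ e ⊗ (e ⊗ ℕ-con 1) ⊗ y ⊕ e ⊗ (e ⊗ (e ⊗ ℕ-con 1)) ⊗ z) ⊗ ℕ-con 6
         ⊜ ℕ-con 6 ⊕ ℕ-con 6 ⊗ (e ⊗ x) ⊕ ℕ-con 3 ⊗ (e ⊗ e ⊗ (ℕ-con 2 ⊗ y)) ⊕ e ⊗ e ⊗ e ⊗ (ℕ-con 6 ⊗ z)) refl e (n C 1) (n C 2) (n C 3) ⟩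
  6 + 6 * (e * (n C 1)) + 3 * (e * e * (2 * (n C 2))) + e * e * e * (6 * (n C 3))
    ≤⟨ ℕ.+-mono-≤ (ℕ.+-mono-≤ (ℕ.≤-reflexive (cong (λ x → 6 + 6 * (e * x)) (nC1≡n n)))
         (ℕ.*-monoʳ-≤ 3 (ℕ.*-monoʳ-≤ (e * e) (2C≤ n)))) (ℕ.*-monoʳ-≤ (e * e * e) (6C≤ n)) ⟩
  6 + 6 * (e * n) + 3 * (e * e * (n * n)) + e * e * e * (n * n * n) ∎
  where
  open ℕ.≤-Reasoning
  e = q ∸ 1

-- For large M the terms of lower order cost less than one extra M³.
6V< : ∀ q N M → (let e = q ∸ 1) → 6 + 6 * (e * N) + 3 * (e * e * (N * N)) < M →
      V q (N * M) 3 * 6 < (e * e * e * (N * N * N) + 1) * (M * M * M)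
6V< q N M@(suc _) small = begin-strict
  V q (N * M) 3 * 6
    ≤⟨ 6V≤ q (N * M) ⟩
  6 + 6 * (e * (N * M)) + 3 * (e * e * (N * M * (N * M))) + e * e * e * (N * M * (N * M) * (N * M))
    ≤⟨ ℕ.+-monoˡ-≤ _ (ℕ.+-monoˡ-≤ _ (ℕ.+-mono-≤ (ℕ.*-monoʳ-≤ 6 1≤MM) (ℕ.*-monoʳ-≤ 6 (ℕ.*-monoʳ-≤ e (ℕ.*-monoʳ-≤ N (ℕ.m≤m*n M M)))))) ⟩
  6 * (M * M) + 6 * (e * (N * (M * M))) + 3 * (e * e * (N * M * (N * M))) + e * e * e * (N * M * (N * M) * (N * M))
    ≡⟨ ℕ-solve 3 (λ e N M → ℕ-con 6 ⊗ (M ⊗ M) ⊕ ℕ-con 6 ⊗ (e ⊗ (N ⊗ (M ⊗ M))) ⊕ ℕ-con 3 ⊗ (e ⊗ e ⊗ (N ⊗ M ⊗ (N ⊗ M))) ⊕ e ⊗ e ⊗ e ⊗ (N ⊗ M ⊗ (N ⊗ M) ⊗ (N ⊗ M))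
         ⊜ (ℕ-con 6 ⊕ ℕ-con 6 ⊗ (e ⊗ N) ⊕ ℕ-con 3 ⊗ (e ⊗ e ⊗ (N ⊗ N))) ⊗ (M ⊗ M) ⊕ e ⊗ e ⊗ e ⊗ (N ⊗ N ⊗ N) ⊗ (M ⊗ M ⊗ M)) refl e N M ⟩
  (6 + 6 * (e * N) + 3 * (e * e * (N * N))) * (M * M) + e * e * e * (N * N * N) * (M * M * M)
    <⟨ ℕ.+-monoˡ-< _ (ℕ.*-monoˡ-< (M * M) small) ⟩
  M * (M * M) + e * e * e * (N * N * N) * (M * M * M)
    ≡⟨ ℕ-solve 2 (λ x M → M ⊗ (M ⊗ M) ⊕ x ⊗ (M ⊗ M ⊗ M) ⊜ (x ⊕ ℕ-con 1) ⊗ (M ⊗ M ⊗ M)) refl (e * e * e * (N * N * N)) M ⟩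
  (e * e * e * (N * N * N) + 1) * (M * M * M) ∎
  where
  open ℕ.≤-Reasoning
  e = q ∸ 1
  1≤MM : 1 ≤ M * M
  1≤MM = s≤s z≤n

n<q^n : ∀ {q} → 1 < q → ∀ n → n < q ^ n
n<q^n 1<q zero    = s≤s z≤n
n<q^n {q} 1<q (suc n) = begin-strict
  suc n          ≤⟨ n<q^n 1<q n ⟩
  q ^ n          <⟨ ℕ.^-monoʳ-< q 1<q (ℕ.n<1+n n) ⟩
  q ^ suc n      ∎
  where open ℕ.≤-Reasoning

-- Here t = m + 1 and ξ ranges over F^m: the codimension is 4 + 3 m, and the length is 4 (Q + 1)
-- points times q^m vectors.
nLen≡ : ∀ Q m → nLen Q (3 * suc m + 1) ≡ 4 * suc Q * (Q ^ 3) ^ m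
nLen≡ Q m = begin
  nLen Q (3 * suc m + 1)                     ≡⟨ cong (nLen Q) (ℕ-solve 1 (λ m → ℕ-con 3 ⊗ (ℕ-con 1 ⊕ m) ⊕ ℕ-con 1 ⊜ ℕ-con 4 ⊕ ℕ-con 3 ⊗ m) refl m) ⟩
  4 * (Q * Q ^ (3 * m)) + 4 * Q ^ (3 * m)    ≡⟨ ℕ-solve 2 (λ Q x → ℕ-con 4 ⊗ (Q ⊗ x) ⊕ ℕ-con 4 ⊗ x ⊜ ℕ-con 4 ⊗ (ℕ-con 1 ⊕ Q) ⊗ x) refl Q (Q ^ (3 * m)) ⟩
  4 * suc Q * Q ^ (3 * m)                    ≡⟨ cong (4 * suc Q *_) (ℕ.^-*-assoc Q 3 m) ⟨
  4 * suc Q * (Q ^ 3) ^ m                    ∎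
  where open ≡.≡-Reasoning

^-codim : ∀ q m → q ^ (3 * suc m + 1) ≡ q * q * q * q * (q ^ m * q ^ m * q ^ m)
^-codim q m = begin
  q ^ (3 * suc m + 1)                       ≡⟨ cong (q ^_) (ℕ-solve 1 (λ m → ℕ-con 3 ⊗ (ℕ-con 1 ⊕ m) ⊕ ℕ-con 1 ⊜ ℕ-con 4 ⊕ m ⊗ ℕ-con 3) refl m) ⟩
  q * (q * (q * (q * q ^ (m * 3))))         ≡⟨ cong (λ x → q * (q * (q * (q * x)))) (ℕ.^-*-assoc q m 3) ⟨
  q * (q * (q * (q * (q ^ m) ^ 3)))         ≡⟨ ℕ-solve 2 (λ q M → q ⊗ (q ⊗ (q ⊗ (q ⊗ (M ⊗ (M ⊗ (M ⊗ ℕ-con 1)))))) ⊜ q ⊗ q ⊗ q ⊗ q ⊗ (M ⊗ M ⊗ M)) refl q (q ^ m) ⟩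
  q * q * q * q * (q ^ m * q ^ m * q ^ m)   ∎
  where open ≡.≡-Reasoning

-- This is 64 z (q³ − e³) > 192 q³ + 1 for q = e + 1, applied to z = (Q + 1)³ = q + 7 + w with q = Q³.
cube-gap : ∀ e w → (let z = suc e + (7 + w)) →
           64 * z * (e * e * e) + 1 + 192 * (suc e * suc e * suc e) < 64 * z * (suc e * suc e * suc e)
cube-gap e w = begin-strict
  64 * z * (e * e * e) + 1 + 192 * (suc e * suc e * suc e)
    <⟨ ℕ.m<m+n _ (s≤s z≤n) ⟩
  -- The added term is the exact difference of the two sides. Its coefficients are positive thanks
  -- to the 7 in z; for z = q the inequality would fail.
  64 * z * (e * e * e) + 1 + 192 * (suc e * suc e * suc e) + suc (318 + 1024 * e + 1152 * (e * e) + 64 * (w * (3 * (e * e) + 3 * e + 1)))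
    ≡⟨ ℕ-solve 2 (λ e w → let z = ℕ-con 1 ⊕ e ⊕ (ℕ-con 7 ⊕ w) ; q = ℕ-con 1 ⊕ e in
         ℕ-con 64 ⊗ z ⊗ (e ⊗ e ⊗ e) ⊕ ℕ-con 1 ⊕ ℕ-con 192 ⊗ (q ⊗ q ⊗ q)
           ⊕ (ℕ-con 1 ⊕ (ℕ-con 318 ⊕ ℕ-con 1024 ⊗ e ⊕ ℕ-con 1152 ⊗ (e ⊗ e) ⊕ ℕ-con 64 ⊗ (w ⊗ (ℕ-con 3 ⊗ (e ⊗ e) ⊕ ℕ-con 3 ⊗ e ⊕ ℕ-con 1))))
         ⊜ ℕ-con 64 ⊗ z ⊗ (q ⊗ q ⊗ q)) refl e w ⟩
  64 * z * (suc e * suc e * suc e) ∎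
  where
  open ℕ.≤-Reasoning
  z = suc e + (7 + w)

-- The bound equals 32/3 ((1 + 1/Q)³ - 3/q). Over the denominator 6 q⁴ it has the numerator 64 (Q +
-- 1)³ q³ - 192 q³, to be compared with 64 (Q + 1)³ e³ + 1, where the 1 is the slack used by
-- `density`.
limit-bound : ∀ d e → (let Q = suc d) → suc e ≡ Q ^ 3 →
  frac (e * e * e * (4 * suc Q * (4 * suc Q) * (4 * suc Q)) + 1) (6 * (suc e * suc e * suc e * suc e))
    ℚ.< ((frac 32 3 ℚ.+ frac 32 Q) ℚ.+ frac 32 (Q ^ 2)) ℚ.- frac 64 (3 * Q ^ 3)
limit-bound d e q≡Q³ = <-minus (≡.subst₂ ℚ._<_ (sym lhs) (sym rhs) (frac-< (X + 128 * q³) D Z D 0<D 0<D (ℕ.*-monoˡ-< D bound)))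
  where
  Q = suc d
  q = suc e
  q³ = q * q * q
  D = 6 * (q * q * q * q)
  X = e * e * e * (4 * suc Q * (4 * suc Q) * (4 * suc Q)) + 1
  Z = 64 * (q * q³) + 192 * (Q * Q * q³) + 192 * (Q * q³)
  0<D : 0 < D
  0<D = s≤s z≤n
  z≡ : suc Q * suc Q * suc Q ≡ q + (7 + (9 * d + 3 * (d * d)))
  z≡ = trans (ℕ-solve 1 (λ d → let Q = ℕ-con 1 ⊕ d ; z = ℕ-con 1 ⊕ Q in
         z ⊗ z ⊗ z ⊜ Q ⊗ (Q ⊗ (Q ⊗ ℕ-con 1)) ⊕ (ℕ-con 7 ⊕ (ℕ-con 9 ⊗ d ⊕ ℕ-con 3 ⊗ (d ⊗ d)))) refl d)
       (cong (_+ (7 + (9 * d + 3 * (d * d)))) (sym q≡Q³))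
  bound : X + 128 * q³ < Z
  -- Adding 64 q³ completes q + 3 Q² + 3 Q to (Q + 1)³ on the right and turns 128 into 192 on the
  -- left.
  bound = ℕ.+-cancelʳ-< (64 * q³) _ _ (begin-strict
    X + 128 * q³ + 64 * q³
      ≡⟨ ℕ-solve 3 (λ e s x → e ⊗ e ⊗ e ⊗ (ℕ-con 4 ⊗ s ⊗ (ℕ-con 4 ⊗ s) ⊗ (ℕ-con 4 ⊗ s)) ⊕ ℕ-con 1 ⊕ ℕ-con 128 ⊗ x ⊕ ℕ-con 64 ⊗ x
           ⊜ ℕ-con 64 ⊗ (s ⊗ s ⊗ s) ⊗ (e ⊗ e ⊗ e) ⊕ ℕ-con 1 ⊕ ℕ-con 192 ⊗ x) refl e (suc Q) q³ ⟩
    64 * (suc Q * suc Q * suc Q) * (e * e * e) + 1 + 192 * q³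
      ≡⟨ cong (λ z → 64 * z * (e * e * e) + 1 + 192 * q³) z≡ ⟩
    64 * (q + (7 + (9 * d + 3 * (d * d)))) * (e * e * e) + 1 + 192 * q³
      <⟨ cube-gap e (9 * d + 3 * (d * d)) ⟩
    64 * (q + (7 + (9 * d + 3 * (d * d)))) * q³
      ≡⟨ ℕ-solve 3 (λ d q x → let Q = ℕ-con 1 ⊕ d in ℕ-con 64 ⊗ (q ⊕ (ℕ-con 7 ⊕ (ℕ-con 9 ⊗ d ⊕ ℕ-con 3 ⊗ (d ⊗ d)))) ⊗ x
           ⊜ ℕ-con 64 ⊗ (q ⊗ x) ⊕ ℕ-con 192 ⊗ (Q ⊗ Q ⊗ x) ⊕ ℕ-con 192 ⊗ (Q ⊗ x) ⊕ ℕ-con 64 ⊗ x) refl d q q³ ⟩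
    Z + 64 * q³ ∎)
    where open ℕ.≤-Reasoning
  32/3≡ : frac 32 3 ≡ frac (64 * (q * q³)) D
  32/3≡ = frac-cong 32 3 (64 * (q * q³)) D (s≤s z≤n) 0<D (ℕ-solve 1 (λ q → ℕ-con 32 ⊗ (ℕ-con 6 ⊗ (q ⊗ q ⊗ q ⊗ q)) ⊜ ℕ-con 64 ⊗ (q ⊗ (q ⊗ q ⊗ q)) ⊗ ℕ-con 3) refl q)
  32/Q≡ : frac 32 Q ≡ frac (192 * (Q * Q * q³)) D
  32/Q≡ = frac-cong 32 Q (192 * (Q * Q * q³)) D (s≤s z≤n) 0<D (trans (ℕ-solve 2 (λ q x → ℕ-con 32 ⊗ (ℕ-con 6 ⊗ (x ⊗ q)) ⊜ ℕ-con 192 ⊗ q ⊗ x) refl q q³)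
    (trans (cong (λ q → 192 * q * q³) q≡Q³) (ℕ-solve 2 (λ Q x → ℕ-con 192 ⊗ (Q ⊗ (Q ⊗ (Q ⊗ ℕ-con 1))) ⊗ x ⊜ ℕ-con 192 ⊗ (Q ⊗ Q ⊗ x) ⊗ Q) refl Q q³)))
  32/Q²≡ : frac 32 (Q ^ 2) ≡ frac (192 * (Q * q³)) D
  32/Q²≡ = frac-cong 32 (Q ^ 2) (192 * (Q * q³)) D (s≤s z≤n) 0<D (trans (ℕ-solve 2 (λ q x → ℕ-con 32 ⊗ (ℕ-con 6 ⊗ (x ⊗ q)) ⊜ ℕ-con 192 ⊗ q ⊗ x) refl q q³)
    (trans (cong (λ q → 192 * q * q³) q≡Q³) (ℕ-solve 2 (λ Q x → ℕ-con 192 ⊗ (Q ⊗ (Q ⊗ (Q ⊗ ℕ-con 1))) ⊗ x ⊜ ℕ-con 192 ⊗ (Q ⊗ x) ⊗ (Q ⊗ (Q ⊗ ℕ-con 1))) refl Q q³)))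
  64/3Q³≡ : frac 64 (3 * Q ^ 3) ≡ frac (128 * q³) D
  64/3Q³≡ = trans (cong (λ x → frac 64 (3 * x)) (sym q≡Q³)) (frac-cong 64 (3 * q) (128 * q³) D (s≤s z≤n) 0<D
    (ℕ-solve 1 (λ q → ℕ-con 64 ⊗ (ℕ-con 6 ⊗ (q ⊗ q ⊗ q ⊗ q)) ⊜ ℕ-con 128 ⊗ (q ⊗ q ⊗ q) ⊗ (ℕ-con 3 ⊗ q)) refl q))
  lhs : frac X D ℚ.+ frac 64 (3 * Q ^ 3) ≡ frac (X + 128 * q³) D
  lhs = trans (cong (frac X D ℚ.+_) 64/3Q³≡) (frac-+ X (128 * q³) 0<D)
  rhs : (frac 32 3 ℚ.+ frac 32 Q) ℚ.+ frac 32 (Q ^ 2) ≡ frac Z D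
  rhs = trans (cong₂ ℚ._+_ (trans (cong₂ ℚ._+_ 32/3≡ 32/Q≡) (frac-+ (64 * (q * q³)) (192 * (Q * Q * q³)) 0<D)) 32/Q²≡)
              (frac-+ (64 * (q * q³) + 192 * (Q * Q * q³)) (192 * (Q * q³)) 0<D)

-- The intermediate rational exceeds the limit of the densities by 1 / (6 q⁴), which absorbs the
-- lower-order terms of the sphere size as soon as q^m > `C₀`. Since q^m > m, every m ≥ `C₀` will
-- do.
density : ∀ d → 0 < d → (let Q = suc d) →
  LiminfLt (λ t → frac (V (Q ^ 3) (nLen Q (3 * t + 1)) 3) ((Q ^ 3) ^ (3 * t + 1)))
           (((frac 32 3 ℚ.+ frac 32 Q) ℚ.+ frac 32 (Q ^ 2)) ℚ.- frac 64 (3 * Q ^ 3))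
density d 0<d = frac (e * e * e * (N * N * N) + 1) (6 * (q * q * q * q)) , limit-bound d e q≡ , λ T → suc (T + C₀) , ℕ.m≤n⇒m≤1+n (ℕ.m≤m+n T C₀) ,
    subst (λ x → frac (V x (nLen Q (3 * suc (T + C₀) + 1)) 3) (x ^ (3 * suc (T + C₀) + 1)) ℚ.< frac (e * e * e * (N * N * N) + 1) (6 * (q * q * q * q))) q≡ (below (T + C₀) (ℕ.m≤n+m C₀ T))
  where
  Q = suc d
  e = ℕ.pred (Q ^ 3)
  q = suc e
  q≡ : suc e ≡ Q ^ 3
  q≡ = ℕ.suc-pred (Q ^ 3) {{ℕ.>-nonZero (ℕ.m^n>0 Q 3)}}
  N = 4 * suc Q
  C₀ = 6 + 6 * (e * N) + 3 * (e * e * (N * N))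
  1<q : 1 < q
  1<q = subst (1 <_) (sym q≡) (ℕ.^-monoʳ-< Q (s≤s 0<d) {0} {3} (s≤s z≤n))
  below : ∀ m → C₀ ≤ m → frac (V q (nLen Q (3 * suc m + 1)) 3) (q ^ (3 * suc m + 1)) ℚ.<
          frac (e * e * e * (N * N * N) + 1) (6 * (q * q * q * q))
  below m C₀≤m = subst (λ n → frac (V q n 3) (q ^ (3 * suc m + 1)) ℚ.< frac X (6 * q⁴)) (sym n≡)
    (frac-< (V q (N * M) 3) (q ^ (3 * suc m + 1)) X (6 * q⁴) (ℕ.m^n>0 q (3 * suc m + 1)) (s≤s z≤n) (begin-strict
      V q (N * M) 3 * (6 * q⁴)      ≡⟨ ℕ.*-assoc (V q (N * M) 3) 6 q⁴ ⟨
      V q (N * M) 3 * 6 * q⁴        <⟨ ℕ.*-monoˡ-< q⁴ (6V< q N M (ℕ.≤-<-trans C₀≤m (n<q^n 1<q m))) ⟩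
      X * (M * M * M) * q⁴          ≡⟨ ℕ-solve 3 (λ x m q → x ⊗ m ⊗ q ⊜ x ⊗ (q ⊗ m)) refl X (M * M * M) q⁴ ⟩
      X * (q⁴ * (M * M * M))        ≡⟨ cong (X *_) (^-codim q m) ⟨
      X * q ^ (3 * suc m + 1)       ∎))
    where
    open ℕ.≤-Reasoning
    M = q ^ m
    q⁴ = q * q * q * q
    X = e * e * e * (N * N * N) + 1
    n≡ : nLen Q (3 * suc m + 1) ≡ N * M
    n≡ = trans (nLen≡ Q m) (cong (λ q → N * q ^ m) (sym q≡))

-- Parameters and indexing of the lengthened code

cube-cancel-≤ : ∀ {m n} → m ^ 3 ≤ n ^ 3 → m ≤ n
cube-cancel-≤ {m} {n} m³≤n³ = ℕ.≮⇒≥ λ n<m → ℕ.<⇒≱ (ℕ.^-monoˡ-< 3 n<m) m³≤n³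

-- The 4 (Q + 1) points need distinct labels β in F, so their number may not exceed q; the strict
-- inequality serves the count of pairs.
4[1+Q]<Q³ : ∀ {Q} → 4 ≤ Q → 4 * suc Q < Q ^ 3
4[1+Q]<Q³ {Q} 4≤Q = begin-strict
  4 * suc Q              <⟨ ℕ.*-monoʳ-< 4 (ℕ.+-monoˡ-< Q (ℕ.<-≤-trans (s≤s (s≤s z≤n)) 4≤Q)) ⟩
  4 * (Q + Q)            ≤⟨ ℕ.m≤m+n _ (8 * Q) ⟩
  4 * (Q + Q) + 8 * Q    ≡⟨ ℕ-solve 1 (λ Q → ℕ-con 4 ⊗ (Q ⊕ Q) ⊕ ℕ-con 8 ⊗ Q ⊜ Q ⊗ ℕ-con 16) refl Q ⟩
  Q * 16                 ≤⟨ ℕ.*-monoʳ-≤ Q (ℕ.*-mono-≤ 4≤Q (ℕ.*-mono-≤ 4≤Q (ℕ.≤-refl {1}))) ⟩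
  Q ^ 3                  ∎
  where open ℕ.≤-Reasoning

-- Each factor is at most q^(m + 2), because N + 1 ≤ q leaves room for the zero term. The product is
-- then at most q^(2 m + 4), and m ≥ 1, that is r ≥ 7, puts this below q^(3 m + 4).
tooFewPairs : ∀ {q N m} → 1 < q → N < q → 1 ≤ m → suc (N * q ^ m * q) * suc (N * q ^ m * q) < q ^ (4 + 3 * m)
tooFewPairs {q} {N} {m} 1<q N<q 1≤m = begin-strict
  suc (N * q ^ m * q) * suc (N * q ^ m * q)  ≤⟨ ℕ.*-mono-≤ bound bound ⟩
  q ^ (2 + m) * q ^ (2 + m)                  ≡⟨ ℕ.^-distribˡ-+-* q (2 + m) (2 + m) ⟨
  q ^ (2 + m + (2 + m))                      <⟨ ℕ.^-monoʳ-< q 1<q (begin-strict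
    2 + m + (2 + m)      ≡⟨ ℕ-solve 1 (λ m → ℕ-con 2 ⊕ m ⊕ (ℕ-con 2 ⊕ m) ⊜ ℕ-con 4 ⊕ ℕ-con 2 ⊗ m ⊕ ℕ-con 0) refl m ⟩
    4 + 2 * m + 0        <⟨ ℕ.+-monoʳ-< (4 + 2 * m) 1≤m ⟩
    4 + 2 * m + m        ≡⟨ ℕ-solve 1 (λ m → ℕ-con 4 ⊕ ℕ-con 2 ⊗ m ⊕ m ⊜ ℕ-con 4 ⊕ ℕ-con 3 ⊗ m) refl m ⟩
    4 + 3 * m            ∎) ⟩
  q ^ (4 + 3 * m)                            ∎
  where
  open ℕ.≤-Reasoning
  0<q : 0 < q
  0<q = ℕ.<-trans (s≤s z≤n) 1<q
  bound : suc (N * q ^ m * q) ≤ q ^ (2 + m)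
  bound = begin
    suc (N * q ^ m * q)          ≤⟨ ℕ.+-monoˡ-≤ _ (ℕ.m^n>0 q {{ℕ.>-nonZero 0<q}} (1 + m)) ⟩
    q * q ^ m + N * q ^ m * q    ≡⟨ ℕ-solve 3 (λ q x N → q ⊗ x ⊕ N ⊗ x ⊗ q ⊜ (ℕ-con 1 ⊕ N) ⊗ (q ⊗ x)) refl q (q ^ m) N ⟩
    suc N * (q * q ^ m)          ≤⟨ ℕ.*-monoˡ-≤ (q * q ^ m) N<q ⟩
    q ^ (2 + m)                  ∎

module _ {c ℓ : Level} {q : ℕ} (F : FiniteField c ℓ q) (p k d : ℕ) (p-prime : Prime p)
         (Q≡pᵏ : suc d ≡ p ^ k) (q≡Q³ : q ≡ suc d ^ 3) (4≤Q : 4 ≤ suc d) where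

  private
    0<d : 0 < d
    0<d = ℕ.≤-trans (s≤s z≤n) (ℕ.s≤s⁻¹ 4≤Q)
    Q = suc d
    4[1+Q]<q : 4 * suc Q < q
    4[1+Q]<q = subst (4 * suc Q <_) (sym q≡Q³) (4[1+Q]<Q³ 4≤Q)

  open Lines F p k d p-prime 0<d Q≡pᵏ q≡Q³ (ℕ.≤-trans (ℕ.m≤m*n 4 (suc Q)) (ℕ.<⇒≤ 4[1+Q]<q)) using (exactlyThree; col)
  open FiniteField F using (Carrier; enum; enum-injective; _≈_)

  β : Fin 4 × Fin (suc Q) → Carrier
  β (l , s) = enum (Fin.inject≤ (Fin.combine l s) (ℕ.<⇒≤ 4[1+Q]<q))

  β-injective : ∀ {j j′} → β j ≈ β j′ → j ≡ j′
  β-injective {l , s} {l′ , s′} e =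
    let l≡ , s≡ = Fin.combine-injective l s l′ s′ (Fin.inject≤-injective _ _ _ _ (enum-injective e)) in cong₂ _,_ l≡ s≡

  module _ (m : ℕ) where
    column : Fin (4 * suc Q * q ^ m) → (Fin 4 × Fin (suc Q)) × (Fin m → Fin q)
    column x = let a , w = Fin.remQuot {4 * suc Q} (q ^ m) x in Fin.remQuot {4} (suc Q) a , finToFun {q} {m} w

    column⁻¹ : Fin 4 × Fin (suc Q) → (Fin m → Fin q) → Fin (4 * suc Q * q ^ m)
    column⁻¹ (l , s) ξ = Fin.combine (Fin.combine l s) (funToFin ξ)

    column-column⁻¹ : ∀ j ξ → column (column⁻¹ j ξ) ≡ (j , finToFun (funToFin ξ))
    column-column⁻¹ (l , s) ξ = trans
      (cong (λ (a , w) → Fin.remQuot {4} (suc Q) a , finToFun {q} {m} w) (Fin.remQuot-combine (Fin.combine l s) (funToFin ξ)))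
      (cong (_, finToFun (funToFin ξ)) (Fin.remQuot-combine l s))

    row : Fin (4 + 3 * m) → Fin 4 ⊎ Fin 3 × Fin m
    row = ⊎-map₂ (Fin.remQuot {3} m) ∘ Fin.splitAt 4

    row⁻¹ : Fin 4 ⊎ Fin 3 × Fin m → Fin (4 + 3 * m)
    row⁻¹ = Fin.join 4 (3 * m) ∘ ⊎-map₂ (uncurry Fin.combine)

    row⁻¹-row : ∀ i → row⁻¹ (row i) ≡ i
    row⁻¹-row i = trans (lem (Fin.splitAt 4 i)) (Fin.join-splitAt 4 (3 * m) i)
      where
      lem : ∀ x → row⁻¹ (⊎-map₂ (Fin.remQuot {3} m) x) ≡ Fin.join 4 (3 * m) x
      lem (inj₁ i) = refl
      lem (inj₂ i) = cong (4 Fin.↑ʳ_) (Fin.combine-remQuot {3} m i)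

    open Concatenation F col exactlyThree β β-injective column column⁻¹
      (λ j ξ → cong proj₁ (column-column⁻¹ j ξ))
      (λ j ξ i → trans (cong (λ x → proj₂ x i) (column-column⁻¹ j ξ)) (Fin.finToFun-funToFin ξ i))
      row row⁻¹ row⁻¹-row

    covering-radius-3 : 1 ≤ m → Σ (Fin (4 + 3 * m) → Fin (4 * suc Q * q ^ m) → Carrier) λ H → HasCoveringRadius F H 3
    covering-radius-3 1≤m = H , covers , coveringRadius≥3 F H (tooFewPairs (ℕ.≤-<-trans (s≤s z≤n) 4[1+Q]<q) 4[1+Q]<q 1≤m)

theorem17 : ∀ {c ℓ : Level} (q′ : ℕ) → IsPrimePower q′ → 64 ≤ q′ ^ 3
    → (F : FiniteField c ℓ (q′ ^ 3))
    → ((t : ℕ) → 7 ≤ 3 * t + 1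
    → Σ (Fin (3 * t + 1) → Fin (nLen q′ (3 * t + 1)) → FiniteField.Carrier F) λ H
    → HasCoveringRadius F H 3)
    × LiminfLt (λ t → frac (V (q′ ^ 3) (nLen q′ (3 * t + 1)) 3) ((q′ ^ 3) ^ (3 * t + 1)))
    (((frac 32 3 +ℚ frac 32 q′) +ℚ frac 32 (q′ ^ 2)) - frac 64 (3 * q′ ^ 3))
theorem17 zero    _ () F
theorem17 (suc d) (p , k , p-prime , _ , Q≡pᵏ) 64≤q F = code , density d (ℕ.≤-trans (s≤s z≤n) (ℕ.s≤s⁻¹ 4≤Q))
  where
  4≤Q : 4 ≤ suc d
  4≤Q = cube-cancel-≤ {4} 64≤q
  code : ∀ t → 7 ≤ 3 * t + 1 → Σ (Fin (3 * t + 1) → Fin (nLen (suc d) (3 * t + 1)) → FiniteField.Carrier F) λ H → HasCoveringRadius F H 3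
  code zero          (s≤s ())
  code (suc zero)    (s≤s (s≤s (s≤s (s≤s ()))))
  code (suc m@(suc _)) _ = ≡.subst₂ (λ r n → Σ (Fin r → Fin n → FiniteField.Carrier F) λ H → HasCoveringRadius F H 3)
    (ℕ-solve 1 (λ m → ℕ-con 4 ⊕ ℕ-con 3 ⊗ m ⊜ ℕ-con 3 ⊗ (ℕ-con 1 ⊕ m) ⊕ ℕ-con 1) refl m)
    (sym (nLen≡ (suc d) m))
    (covering-radius-3 F p k d p-prime Q≡pᵏ refl 4≤Q m (s≤s z≤n))
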